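{- Let $G$ be a connected input graph, and let $X$ be a dominating set of $G$. Then INDEPENDENT CUTSET with $X$ given as an additional input can be solved in time $\mathcal{O}^*(3^k)$, where $k=|X|$.
   Context: All graphs are finite, simple, loopless and undirected. A set $S$ of vertices of a graph $G$ is a cutset of $G$ if $G-S$ is disconnected; it is an independent set if its vertices are pairwise nonadjacent. An independent cutset of $G$ is a set of vertices that is both a cutset and an independent set of $G$. INDEPENDENT CUTSET is the decision problem: given a connected graph $G$, does $G$ have an independent cutset? A dominating set of $G$ is a set of vertices $X$ such that every vertex of $G$ is in $X$ or has a neighbor in $X$. The notation $\mathcal{O}^*$ is the $\mathcal{O}$-notation with factors polynomial in the input size suppressed. -}

module Defs where

open import Data.Bool using (Bool; true; false; T; if_then_else_)
open import Data.Fin using (Fin)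
open import Data.Fin.Subset using (Subset; _∈_; ⊤; ∁; ∣_∣)
open import Data.List using (List; foldr; tabulate; map)
open import Data.Nat using (ℕ; suc; _+_; _*_; _^_; _≤_; _≡ᵇ_)
open import Data.Product using (∃-syntax; Σ-syntax; _×_)
open import Data.Sum using (_⊎_)
open import Data.Vec using (toList)
open import Relation.Binary.Construct.Closure.ReflexiveTransitive using (Star)
open import Relation.Binary.PropositionalEquality using (_≡_)
open import Relation.Nullary using (¬_; Dec; does)

------------------------------------------------------------------------
-- Graphs

record Graph (n : ℕ) : Set where
  field
    adj      : Fin n → Fin n → Bool
    adj-sym  : ∀ {u v} → T (adj u v) → T (adj v u)
    loopless : ∀ {u} → ¬ T (adj u u)

  Adj : Fin n → Fin n → Set
  Adj u v = T (adj u v)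

open Graph public

module _ {n : ℕ} (G : Graph n) where

  -- Adjacency in the subgraph G[W] induced by W.
  AdjIn : Subset n → Fin n → Fin n → Set
  AdjIn W u v = u ∈ W × v ∈ W × Adj G u v

  -- Connectedness of G[W].  The graph without vertices is not disconnected,
  -- so the whole vertex set is never a cutset.
  ConnectedOn : Subset n → Set
  ConnectedOn W = ∀ u v → u ∈ W → v ∈ W → Star (AdjIn W) u v

  Connected : Set
  Connected = ConnectedOn ⊤

  Cutset : Subset n → Set
  Cutset S = ¬ ConnectedOn (∁ S)

  Independent : Subset n → Set
  Independent S = ∀ u v → u ∈ S → v ∈ S → ¬ Adj G u v

  IndependentCutset : Subset n → Set
  IndependentCutset S = Cutset S × Independent S

  Dominating : Subset n → Set
  Dominating X = ∀ v → v ∈ X ⊎ (∃[ u ] (u ∈ X × Adj G v u))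

------------------------------------------------------------------------
-- Model of computation: the language WHILE over binary trees, with its unit
-- cost measure (N. D. Jones, "Computability and Complexity from a
-- Programming Perspective").  Trees are immutable and variables hold
-- references to them, so every unit of cost is a constant number of steps
-- of a random access machine.

infixr 5 _∙_

data Tree : Set where
  nil : Tree
  _∙_ : Tree → Tree → Tree

size : Tree → ℕ
size nil     = 1
size (l ∙ r) = suc (size l + size r)

head tail : Tree → Tree
head nil     = nil
head (l ∙ r) = l
tail nil     = nil
tail (l ∙ r) = r

Var : Set
Var = ℕ

data Expr : Set where
  var   : Var → Expr
  `nil  : Expr
  `cons : Expr → Expr → Expr
  `hd   : Expr → Expr
  `tl   : Expr → Expr

infixr 4 _⨟_
infix  5 _≔_

-- if e C D and while e C test whether the value of e differs from nil.
data Cmd : Set where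
  _≔_   : Var → Expr → Cmd
  _⨟_   : Cmd → Cmd → Cmd
  if    : Expr → Cmd → Cmd → Cmd
  while : Expr → Cmd → Cmd

Store : Set
Store = Var → Tree

_[_↦_] : Store → Var → Tree → Store
(σ [ x ↦ a ]) y = if x ≡ᵇ y then a else σ y

eval : Expr → Store → Tree
eval (var x)     σ = σ x
eval `nil        σ = nil
eval (`cons e f) σ = eval e σ ∙ eval f σ
eval (`hd e)     σ = head (eval e σ)
eval (`tl e)     σ = tail (eval e σ)

cost : Expr → ℕ
cost (var x)     = 1
cost `nil        = 1
cost (`cons e f) = suc (cost e + cost f)
cost (`hd e)     = suc (cost e)
cost (`tl e)     = suc (cost e)

-- σ ⊢ C ⇓ τ ∣ t : started in store σ, the command C terminates in store τ
-- after time t.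
infix 3 _⊢_⇓_∣_

data _⊢_⇓_∣_ : Store → Cmd → Store → ℕ → Set where
  assign : ∀ {σ x e} →
    σ ⊢ x ≔ e ⇓ σ [ x ↦ eval e σ ] ∣ suc (cost e)
  seq : ∀ {σ τ υ C D s t} →
    σ ⊢ C ⇓ τ ∣ s → τ ⊢ D ⇓ υ ∣ t →
    σ ⊢ C ⨟ D ⇓ υ ∣ s + t
  if-true : ∀ {σ τ e C D l r t} →
    eval e σ ≡ l ∙ r → σ ⊢ C ⇓ τ ∣ t →
    σ ⊢ if e C D ⇓ τ ∣ suc (cost e + t)
  if-false : ∀ {σ τ e C D t} →
    eval e σ ≡ nil → σ ⊢ D ⇓ τ ∣ t →
    σ ⊢ if e C D ⇓ τ ∣ suc (cost e + t)
  while-true : ∀ {σ τ υ e C l r s t} →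
    eval e σ ≡ l ∙ r → σ ⊢ C ⇓ τ ∣ s → τ ⊢ while e C ⇓ υ ∣ t →
    σ ⊢ while e C ⇓ υ ∣ suc (cost e + (s + t))
  while-false : ∀ {σ e C} →
    eval e σ ≡ nil →
    σ ⊢ while e C ⇓ σ ∣ suc (cost e)

-- Variable 0 holds the input at the start and the output at the end.
initial : Tree → Store
initial a = (λ _ → nil) [ 0 ↦ a ]

Computes_from_to_inTime_ : Cmd → Tree → Tree → ℕ → Set
Computes C from a to b inTime t =
  ∃[ τ ] ((initial a ⊢ C ⇓ τ ∣ t) × τ 0 ≡ b)

------------------------------------------------------------------------
-- Parameterized decision problems

encodeBool : Bool → Tree
encodeBool false = nil
encodeBool true  = nil ∙ nil

encodeList : List Tree → Tree
encodeList = foldr _∙_ nil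

record ParameterizedProblem : Set₁ where
  field
    Instance  : Set
    encode    : Instance → Tree
    parameter : Instance → ℕ
    Yes       : Instance → Set

-- Solvable in time O*(f(k)): a single program decides every instance within
-- time c · f(k) · N^d, where k is the parameter and N the input size.
SolvableInTimeO* : ParameterizedProblem → (ℕ → ℕ) → Set
SolvableInTimeO* P f =
  Σ[ C ∈ Cmd ] Σ[ c ∈ ℕ ] Σ[ d ∈ ℕ ]
    (∀ (I : Instance) →
      Σ[ answer ∈ Dec (Yes I) ] Σ[ t ∈ ℕ ]
        (Computes C from encode I to encodeBool (does answer) inTime t
        × t ≤ c * f (parameter I) * size (encode I) ^ d))
  where open ParameterizedProblem P

------------------------------------------------------------------------
-- INDEPENDENT CUTSET with a dominating set as additional input

record DominatedGraph : Set where
  field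
    {n}        : ℕ
    G          : Graph n
    connected  : Connected G
    X          : Subset n
    dominating : Dominating G X

-- The adjacency matrix, as a list of rows.
encodeGraph : ∀ {n} → Graph n → Tree
encodeGraph G =
  encodeList (tabulate λ u → encodeList (tabulate λ v → encodeBool (adj G u v)))

-- The characteristic vector.
encodeSubset : ∀ {n} → Subset n → Tree
encodeSubset X = encodeList (map encodeBool (toList X))

independentCutsetByDominatingSet : ParameterizedProblem
independentCutsetByDominatingSet = record
  { Instance  = DominatedGraph
  ; encode    = λ I → encodeGraph (G I) ∙ encodeSubset (X I)
  ; parameter = λ I → ∣ X I ∣
  ; Yes       = λ I → ∃[ S ] IndependentCutset (G I) S
  }
  where open DominatedGraph

{-# OPTIONS --safe #-}

-- An independent cutset is a colouring of the vertices by A, S and B that uses A and B, in which S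
-- is independent and no edge joins A to B.  This is a binary constraint problem, represented by the
-- list of admissible pairs of literals (vertex , colour).  Guess the colours of the vertices of X in
-- all 3 ^ k ways.  Since X dominates, every vertex is then left with at most two colours, so that
-- the remaining problem is an instance of 2-SAT: eliminating a vertex w, which keeps a pair (p , q)
-- only if p and q are both compatible with a common colour of w, preserves solvability.  After the
-- elimination of all vertices a solution with a in A and b in B exists if and only if the pair of
-- literals ((a , A) , (b , B)) is still there.  Elimination only removes pairs, so that each of the
-- 3 ^ k relations is dealt with in polynomial time.
module Submission where

open import Data.Bool using (Bool; true; false; T; not; _∧_; if_then_else_)
open import Data.Bool.ListAction using (any)
open import Data.Bool.Properties using (T-∧; T?)
open import Data.Empty using (⊥; ⊥-elim)
open import Data.Fin using (Fin; zero; suc; toℕ; fromℕ<)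
open import Data.Fin.Properties as Fin using (toℕ-injective; toℕ-fromℕ<; toℕ<n)
open import Data.Fin.Subset using (Subset; ∁; ∣_∣; inside; outside) renaming (_∈_ to _∈ˢ_; _∉_ to _∉ˢ_)
open import Data.Fin.Subset.Properties using (_∈?_; x∈∁p⇒x∉p; x∉p⇒x∈∁p)
open import Data.List using (List; []; _∷_; _++_; _ʳ++_; length; reverse; foldr; map; concatMap;
  filterᵇ; replicate; drop; downFrom; cartesianProduct; allFin; tabulate)
open import Data.List.Membership.Propositional using (_∈_; find; lose)
open import Data.List.Membership.Propositional.Properties
open import Data.List.Properties
  using (length-reverse; reverse-involutive; ++-is-foldr; length-++; length-map; length-tabulate; filter-++)
open import Data.List.Relation.Unary.All as All using (All; []; _∷_)
open import Data.List.Relation.Unary.All.Properties using (¬All⇒Any¬; ++⁺)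
open import Data.List.Relation.Unary.Any using (here; there)
open import Data.List.Relation.Unary.Any.Properties using (any⁺; any⁻)
open import Data.Nat using (ℕ; zero; suc; pred; _+_; _*_; _^_; _∸_; _≡ᵇ_; _≤_; _<_; z≤n; s≤s; NonZero)
open import Data.Nat.Properties hiding (_≟_)
open import Data.Nat.Tactic.RingSolver using (solve-∀)
open import Data.Product using (∃-syntax; _×_; _,_; proj₁; proj₂)
open import Data.Sum using (_⊎_; inj₁; inj₂; [_,_]′)
open import Data.Unit using (tt) renaming (⊤ to Unit)
open import Data.Vec as Vec using (Vec; []; _∷_; toList)
open import Data.Vec.Properties using ([]=⇒lookup; lookup⇒[]=; lookup∘tabulate)
open import Effect.Monad using (RawMonad)
open import Function using (_∘_; const; id; case_of_)
open import Function.Bundles using (Equivalence)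
open import Relation.Binary.Construct.Closure.ReflexiveTransitive using (Star; ε; _◅_; _◅◅_)
open import Relation.Binary.PropositionalEquality
  using (_≡_; refl; sym; trans; cong; cong₂; subst; subst₂)
open import Relation.Nullary using (¬_; Dec; yes; no; does)
open import Relation.Nullary.Decidable using (decidable-stable; ¬¬-excluded-middle; dec-true; map′)
open import Relation.Nullary.Negation using (¬¬-Monad; contradiction)

open import Defs

open Equivalence using (to; from)

-- Polynomials

-- A solution is treated as a clique: a set of literals all of whose pairs, including the loops
-- `(p , p)`, lie in the relation. The loops carry the restrictions on single vertices, so guessing
-- and eliminating both amount to removing pairs, and guessing the colour of `x` is `elim` with a
-- one-element list of colours. Two colours suffice because of a Helly-type property: a clique
-- cannot be extended to `w` only if every remaining colour of `w` is blocked by some literal of the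
-- clique. With at most two colours two literals witness this, and a binary relation can record it;
-- three literals that block three colours jointly would escape it. The obstacle in the time
-- analysis is that the guesses form a list of length `3 ^ k`, where a bound polynomial in the total
-- size would allow a power of `3 ^ k`. The programs for `any` and `concatMap` are therefore
-- analysed with the number of entries kept apart from the cost per entry, and only the work on a
-- single relation is measured by a polynomial.

infixl 6 _⊕_
infixl 7 _⊛_

-- Bounds are kept as syntax closed under composition, so that monotonicity and the final shape
-- `c * n ^ d` follow by induction.
data Poly : Set where
  con     : ℕ → Poly
  ι       : Poly
  _⊕_ _⊛_ : Poly → Poly → Poly
  _⊚_     : Poly → Poly → Poly

⟪_⟫ : Poly → ℕ → ℕ
⟪ con k ⟫ n = k
⟪ ι ⟫     n = n
⟪ p ⊕ q ⟫ n = ⟪ p ⟫ n + ⟪ q ⟫ n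
⟪ p ⊛ q ⟫ n = ⟪ p ⟫ n * ⟪ q ⟫ n
⟪ p ⊚ q ⟫ n = ⟪ p ⟫ (⟪ q ⟫ n)

poly-mono : ∀ p {m n} → m ≤ n → ⟪ p ⟫ m ≤ ⟪ p ⟫ n
poly-mono (con k) m≤n = ≤-refl
poly-mono ι       m≤n = m≤n
poly-mono (p ⊕ q) m≤n = +-mono-≤ (poly-mono p m≤n) (poly-mono q m≤n)
poly-mono (p ⊛ q) m≤n = *-mono-≤ (poly-mono p m≤n) (poly-mono q m≤n)
poly-mono (p ⊚ q) m≤n = poly-mono p (poly-mono q m≤n)

^-distribʳ-* : ∀ m n d → (m * n) ^ d ≡ m ^ d * n ^ d
^-distribʳ-* m n zero    = refl
^-distribʳ-* m n (suc d) =
  trans (cong (m * n *_) (^-distribʳ-* m n d)) ([m*n]*[o*p]≡[m*o]*[n*p] m n (m ^ d) (n ^ d))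

poly-bounded : ∀ p → ∃[ c ] ∃[ d ] (∀ n .{{_ : NonZero n}} → ⟪ p ⟫ n ≤ c * n ^ d)
poly-bounded (con k) = k , 0 , λ n → ≤-reflexive (sym (*-identityʳ k))
poly-bounded ι = 1 , 1 , λ n → ≤-reflexive (sym (trans (*-identityˡ _) (*-identityʳ n)))
poly-bounded (p ⊕ q) with poly-bounded p | poly-bounded q
... | c , d , p≤ | c′ , d′ , q≤ = c + c′ , d + d′ , λ n → begin
  ⟪ p ⟫ n + ⟪ q ⟫ n                     ≤⟨ +-mono-≤ (p≤ n) (q≤ n) ⟩
  c * n ^ d + c′ * n ^ d′               ≤⟨ +-mono-≤ (*-monoʳ-≤ c (^-monoʳ-≤ n (m≤m+n d d′)))
                                                    (*-monoʳ-≤ c′ (^-monoʳ-≤ n (m≤n+m d′ d))) ⟩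
  c * n ^ (d + d′) + c′ * n ^ (d + d′)  ≡⟨ *-distribʳ-+ (n ^ (d + d′)) c c′ ⟨
  (c + c′) * n ^ (d + d′)               ∎
  where open ≤-Reasoning
poly-bounded (p ⊛ q) with poly-bounded p | poly-bounded q
... | c , d , p≤ | c′ , d′ , q≤ = c * c′ , d + d′ , λ n → begin
  ⟪ p ⟫ n * ⟪ q ⟫ n            ≤⟨ *-mono-≤ (p≤ n) (q≤ n) ⟩
  c * n ^ d * (c′ * n ^ d′)    ≡⟨ swap c (n ^ d) c′ (n ^ d′) ⟩
  c * c′ * (n ^ d * n ^ d′)    ≡⟨ cong (c * c′ *_) (^-distribˡ-+-* n d d′) ⟨
  c * c′ * n ^ (d + d′)        ∎
  where
  open ≤-Reasoning
  swap : ∀ a b a′ b′ → a * b * (a′ * b′) ≡ a * a′ * (b * b′)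
  swap = solve-∀
poly-bounded (p ⊚ q) with poly-bounded p | poly-bounded q
... | c , d , p≤ | c′ , d′ , q≤ = c * suc c′ ^ d , d′ * d , λ n → begin
  -- The bound on `p` is available only at nonzero arguments, and `c′` may be 0; hence `suc c′`.
  ⟪ p ⟫ (⟪ q ⟫ n)                ≤⟨ poly-mono p (≤-trans (q≤ n) (*-monoˡ-≤ (n ^ d′) (n≤1+n c′))) ⟩
  ⟪ p ⟫ (suc c′ * n ^ d′)        ≤⟨ p≤ (suc c′ * n ^ d′) {{m*n≢0 (suc c′) (n ^ d′) {{_}} {{m^n≢0 n d′}}}} ⟩
  c * (suc c′ * n ^ d′) ^ d      ≡⟨ cong (c *_) (^-distribʳ-* (suc c′) (n ^ d′) d) ⟩
  c * (suc c′ ^ d * (n ^ d′) ^ d) ≡⟨ *-assoc c (suc c′ ^ d) ((n ^ d′) ^ d) ⟨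
  c * suc c′ ^ d * (n ^ d′) ^ d  ≡⟨ cong (c * suc c′ ^ d *_) (^-*-assoc n d′ d) ⟩
  c * suc c′ ^ d * n ^ (d′ * d)  ∎
  where open ≤-Reasoning

-- Running time of WHILE programs on encoded data

infixr 4 _⊗_

data Ty : Set where
  unit bool nat col : Ty
  _⊗_               : Ty → Ty → Ty
  list              : Ty → Ty

⟦_⟧ : Ty → Set
⟦ unit ⟧   = Unit
⟦ bool ⟧   = Bool
⟦ nat ⟧    = ℕ
⟦ col ⟧    = Fin 3
⟦ A ⊗ B ⟧  = ⟦ A ⟧ × ⟦ B ⟧
⟦ list A ⟧ = List ⟦ A ⟧

encodeℕ : ℕ → Tree
encodeℕ zero    = nil
encodeℕ (suc n) = nil ∙ encodeℕ n

enc : ∀ A → ⟦ A ⟧ → Tree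
enc unit     _        = nil
enc bool     b        = encodeBool b
enc nat      n        = encodeℕ n
enc col      c        = encodeℕ (toℕ c)
enc (A ⊗ B)  (a , b)  = enc A a ∙ enc B b
enc (list A) []       = nil
enc (list A) (x ∷ xs) = enc A x ∙ enc (list A) xs

-- Calling convention: variable 0 holds the argument and then the result, variable 1 holds a stack
-- that has to be restored, and all other variables are scratch.
Runs : Cmd → Tree → Tree → ℕ → Set
Runs C a b s = ∀ σ → σ 0 ≡ a →
  ∃[ τ ] ∃[ t ] ((σ ⊢ C ⇓ τ ∣ t) × τ 0 ≡ b × τ 1 ≡ σ 1 × t ≤ s)

private variable
  a b c : Tree
  C D E : Cmd
  s t u : ℕ

runs-≤ : s ≤ t → Runs C a b s → Runs C a b t
runs-≤ s≤t r σ eq with r σ eq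
... | τ , t , C⇓ , p , q , t≤ = τ , t , C⇓ , p , q , ≤-trans t≤ s≤t

runs-assign : ∀ e → (∀ σ → σ 0 ≡ a → eval e σ ≡ b) → Runs (0 ≔ e) a b (suc (cost e))
runs-assign e h σ eq = _ , _ , assign , h σ eq , refl , ≤-refl

runs-seq : Runs C a b s → Runs D b c t → Runs (C ⨟ D) a c (s + t)
runs-seq r q σ eq with r σ eq
... | τ , _ , C⇓ , p₀ , p₁ , ≤s with q τ p₀
... | υ , _ , D⇓ , q₀ , q₁ , ≤t =
  υ , _ , seq C⇓ D⇓ , q₀ , trans q₁ p₁ , +-mono-≤ ≤s ≤t

-- Since `C` may overwrite all scratch variables, the argument is saved on the stack in variable 1.
-- While `D` runs, the result of `C` is kept there beside it.
pairCmd : Cmd → Cmd → Cmd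
pairCmd C D =
  1 ≔ `cons (var 0) (var 1) ⨟
  C ⨟
  1 ≔ `cons (`cons (var 0) (`hd (var 1))) (`tl (var 1)) ⨟
  0 ≔ `tl (`hd (var 1)) ⨟
  D ⨟
  0 ≔ `cons (`hd (`hd (var 1))) (var 0) ⨟
  1 ≔ `tl (var 1)

-- The assignments cost 25 in total; this constant, like several later ones, is rounded up.
runs-pair : Runs C a b s → Runs D a c t → Runs (pairCmd C D) a (b ∙ c) (28 + (s + t))
runs-pair {C = C} {s = s} {D = D} {t = t} r q σ refl
  with r (σ [ 1 ↦ σ 0 ∙ σ 1 ]) refl
... | τ , t₁ , C⇓ , p₀ , p₁ , ≤s
  with q ((τ [ 1 ↦ (τ 0 ∙ head (τ 1)) ∙ tail (τ 1) ]) [ 0 ↦ head (τ 1) ]) (cong head p₁)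
... | υ , t₂ , D⇓ , q₀ , q₁ , ≤t =
  _ , _ ,
  seq assign (seq C⇓ (seq assign (seq assign (seq D⇓ (seq assign assign))))) ,
  cong₂ _∙_ (trans (cong (λ x → head (head x)) q₁) p₀) q₀ ,
  trans (cong tail q₁) (cong tail p₁) ,
  (begin
    4 + (t₁ + (8 + (4 + (t₂ + (6 + 3))))) ≤⟨ +-monoʳ-≤ 4 (+-mono-≤ ≤s (+-monoʳ-≤ 12 (+-monoˡ-≤ 9 ≤t))) ⟩
    4 + (s + (8 + (4 + (t + (6 + 3)))))   ≡⟨ arith s t ⟩
    25 + (s + t)                          ≤⟨ +-monoˡ-≤ (s + t) (m≤m+n 25 3) ⟩
    28 + (s + t) ∎)
  where
  open ≤-Reasoning
  arith : ∀ s t → 4 + (s + (8 + (4 + (t + (6 + 3))))) ≡ 25 + (s + t)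
  arith = solve-∀

ifCmd : Cmd → Cmd → Cmd → Cmd
ifCmd C D E =
  1 ≔ `cons (var 0) (var 1) ⨟
  C ⨟
  -- A scratch variable can hold the outcome of the test because no subprogram runs between here and
  -- the branching.
  2 ≔ var 0 ⨟
  0 ≔ `hd (var 1) ⨟
  1 ≔ `tl (var 1) ⨟
  if (var 2) D E

runs-if : ∀ v → Runs C a (encodeBool v) s →
          (v ≡ true → Runs D a b t) → (v ≡ false → Runs E a b u) →
          Runs (ifCmd C D E) a b (20 + (s + (t + u)))
runs-if {C = C} {s = s} {t = t} {u = u} v r q q′ σ refl
  with r (σ [ 1 ↦ σ 0 ∙ σ 1 ]) refl
... | τ , t₁ , C⇓ , p₀ , p₁ , ≤s = branch v q q′ p₀
  where
  υ : Store
  υ = ((τ [ 2 ↦ τ 0 ]) [ 0 ↦ head (τ 1) ]) [ 1 ↦ tail (τ 1) ]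
  bound : ∀ {t₂} → t₂ ≤ t + u →
          4 + (t₁ + (2 + (3 + (3 + (2 + t₂))))) ≤ 20 + (s + (t + u))
  bound {t₂} t₂≤ = begin
    4 + (t₁ + (10 + t₂))       ≤⟨ +-monoʳ-≤ 4 (+-mono-≤ ≤s (+-monoʳ-≤ 10 t₂≤)) ⟩
    4 + (s + (10 + (t + u)))   ≡⟨ arith s (t + u) ⟩
    14 + (s + (t + u))         ≤⟨ +-monoˡ-≤ (s + (t + u)) (m≤m+n 14 6) ⟩
    20 + (s + (t + u))         ∎
    where
    open ≤-Reasoning
    arith : ∀ s t → 4 + (s + (10 + t)) ≡ 14 + (s + t)
    arith = solve-∀
  branch : ∀ v → (v ≡ true → Runs _ _ _ t) → (v ≡ false → Runs _ _ _ u) →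
           τ 0 ≡ encodeBool v → _
  branch true q _ p₀ with q refl υ (cong head p₁)
  ... | ρ , _ , D⇓ , q₀ , q₁ , ≤t =
    ρ , _ , seq assign (seq C⇓ (seq assign (seq assign (seq assign (if-true p₀ D⇓))))) ,
    q₀ , trans q₁ (cong tail p₁) , bound (≤-trans ≤t (m≤m+n t u))
  branch false _ q p₀ with q refl υ (cong head p₁)
  ... | ρ , _ , E⇓ , q₀ , q₁ , ≤u =
    ρ , _ , seq assign (seq C⇓ (seq assign (seq assign (seq assign (if-false p₀ E⇓))))) ,
    q₀ , trans q₁ (cong tail p₁) , bound (≤-trans ≤u (m≤n+m u t))

reverseLoop : Cmd
reverseLoop = while (var 3) (2 ≔ `cons (`hd (var 3)) (var 2) ⨟ 3 ≔ `tl (var 3))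

-- A loop consumes a list from the front, whereas `foldr` starts at the back; the list is therefore
-- reversed beforehand, with environment and accumulator left in place.
reverseCmd : Cmd
reverseCmd =
  2 ≔ `nil ⨟
  3 ≔ `tl (`tl (var 0)) ⨟
  reverseLoop ⨟
  0 ≔ `cons (`hd (var 0)) (`cons (`hd (`tl (var 0))) (var 2))

reverse-loop : ∀ A xs acc σ → σ 3 ≡ enc (list A) xs → σ 2 ≡ enc (list A) acc →
  ∃[ τ ] ((σ ⊢ reverseLoop ⇓ τ ∣ 2 + length xs * 10) ×
          τ 2 ≡ enc (list A) (xs ʳ++ acc) × τ 0 ≡ σ 0 × τ 1 ≡ σ 1)
reverse-loop A []       acc σ e₃ e₂ = σ , while-false e₃ , e₂ , refl , refl
reverse-loop A (x ∷ xs) acc σ e₃ e₂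
  with reverse-loop A xs (x ∷ acc)
         ((σ [ 2 ↦ head (σ 3) ∙ σ 2 ]) [ 3 ↦ tail (σ 3) ])
         (cong tail e₃) (cong₂ _∙_ (cong head e₃) e₂)
... | τ , W⇓ , p₂ , p₀ , p₁ =
  τ ,
  subst (σ ⊢ reverseLoop ⇓ τ ∣_) (arith (length xs)) (while-true e₃ (seq assign assign) W⇓) ,
  p₂ , p₀ , p₁
  where
  arith : ∀ n → 2 + (5 + 3 + (2 + n * 10)) ≡ 2 + (10 + n * 10)
  arith = solve-∀

runs-reverse : ∀ A xs → Runs reverseCmd (a ∙ b ∙ enc (list A) xs)
                                        (a ∙ b ∙ enc (list A) (reverse xs))
                                        (17 + length xs * 10)
runs-reverse A xs σ e
  with reverse-loop A xs [] ((σ [ 2 ↦ nil ]) [ 3 ↦ tail (tail (σ 0)) ])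
         (cong (λ x → tail (tail x)) e) refl
... | τ , W⇓ , p₂ , p₀ , p₁ =
  _ , _ , seq assign (seq assign (seq W⇓ assign)) ,
  cong₂ _∙_ (cong head (trans p₀ e))
            (cong₂ _∙_ (cong (λ x → head (tail x)) (trans p₀ e)) p₂) ,
  p₁ , ≤-reflexive (arith (length xs))
  where
  arith : ∀ n → 2 + (4 + (2 + n * 10 + 9)) ≡ 17 + n * 10
  arith = solve-∀

foldrBody : Cmd → Cmd
foldrBody C =
  1 ≔ `cons (var 0) (var 1) ⨟
  0 ≔ `cons (`hd (var 0)) (`cons (`hd (`tl (`tl (var 0)))) (`hd (`tl (var 0)))) ⨟
  C ⨟
  0 ≔ `cons (`hd (`hd (var 1))) (`cons (var 0) (`tl (`tl (`tl (`hd (var 1)))))) ⨟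
  1 ≔ `tl (var 1)

foldrLoop : Cmd → Cmd
foldrLoop C = while (`tl (`tl (var 0))) (foldrBody C)

foldrCmd : Cmd → Cmd
foldrCmd C = reverseCmd ⨟ foldrLoop C ⨟ 0 ≔ `hd (`tl (var 0))

module _ {G A S : Ty} {C : Cmd} (g : ⟦ G ⟧) (h : ⟦ A ⟧ → ⟦ S ⟧ → ⟦ S ⟧) (s₀ : ⟦ S ⟧) (B : ℕ) where

  -- The cost of `C` may grow with the accumulator, so the bound `B` is demanded only for the
  -- accumulators that occur in this fold.
  StepsRun : List ⟦ A ⟧ → Set
  StepsRun []       = Unit
  StepsRun (x ∷ xs) =
    Runs C (enc (G ⊗ A ⊗ S) (g , x , foldr h s₀ xs)) (enc S (foldr h s₀ (x ∷ xs))) B × StepsRun xs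

  stepsRun-ʳ++ : ∀ ys {zs} → StepsRun (ys ʳ++ zs) → StepsRun zs
  stepsRun-ʳ++ []       r = r
  stepsRun-ʳ++ (y ∷ ys) r = proj₂ (stepsRun-ʳ++ ys r)

  -- Loop invariant: `zs` is already folded into the accumulator, `ys` is the rest in reverse, and
  -- `ys ʳ++ zs` is the whole list. Besides the call, an iteration costs 4 for the test and 31 for
  -- the assignments.
  foldr-loop : ∀ ys zs → StepsRun (ys ʳ++ zs) →
    Runs (foldrLoop C) (enc (G ⊗ S ⊗ list A) (g , foldr h s₀ zs , ys))
                       (enc (G ⊗ S ⊗ list A) (g , foldr h s₀ (ys ʳ++ zs) , []))
                       (4 + length ys * (35 + B))
  foldr-loop []       zs r σ e = σ , _ , while-false (cong (λ x → tail (tail x)) e) , e , refl , ≤-refl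
  foldr-loop (y ∷ ys) zs r σ e
    with proj₁ (stepsRun-ʳ++ ys r)
           ((σ [ 1 ↦ σ 0 ∙ σ 1 ])
              [ 0 ↦ head (σ 0) ∙ head (tail (tail (σ 0))) ∙ head (tail (σ 0)) ])
           (cong (λ x → head x ∙ head (tail (tail x)) ∙ head (tail x)) e)
  ... | τ , t₁ , C⇓ , p₀ , p₁ , ≤B
    with foldr-loop ys (y ∷ zs) r
           ((τ [ 0 ↦ head (head (τ 1)) ∙ τ 0 ∙ tail (tail (tail (head (τ 1)))) ])
              [ 1 ↦ tail (τ 1) ])
           (cong₂ _∙_ (trans (cong (λ x → head (head x)) p₁) (cong head e))
             (cong₂ _∙_ p₀ (trans (cong (λ x → tail (tail (tail (head x)))) p₁)
                                  (cong (λ x → tail (tail (tail x))) e))))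
  ... | υ , t₂ , W⇓ , q₀ , q₁ , t₂≤ =
    υ , _ ,
    while-true (cong (λ x → tail (tail x)) e)
      (seq assign (seq assign (seq C⇓ (seq assign assign)))) W⇓ ,
    q₀ , trans q₁ (cong tail p₁) ,
    (begin
      4 + (4 + (12 + (t₁ + (12 + 3))) + t₂)
        ≤⟨ +-monoʳ-≤ 4 (+-mono-≤ (+-monoʳ-≤ 16 (+-monoˡ-≤ 15 ≤B)) t₂≤) ⟩
      4 + (4 + (12 + (B + (12 + 3))) + (4 + length ys * (35 + B)))
        ≡⟨ arith (length ys * (35 + B)) B ⟩
      4 + (35 + B + length ys * (35 + B)) ∎)
    where
    open ≤-Reasoning
    arith : ∀ n B → 4 + (4 + (12 + (B + (12 + 3))) + (4 + n)) ≡ 4 + (35 + B + n)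
    arith = solve-∀

  runs-foldr : ∀ xs → StepsRun xs →
    Runs (foldrCmd C) (enc (G ⊗ S ⊗ list A) (g , s₀ , xs)) (enc S (foldr h s₀ xs))
         (30 + length xs * (50 + B))
  runs-foldr xs r =
    runs-≤ bound (runs-seq (runs-reverse A xs) (runs-seq loop
      (runs-assign (`hd (`tl (var 0))) λ σ e → cong (λ x → head (tail x)) e)))
    where
    open ≤-Reasoning
    loop : Runs (foldrLoop C) (enc (G ⊗ S ⊗ list A) (g , s₀ , reverse xs))
                              (enc (G ⊗ S ⊗ list A) (g , foldr h s₀ xs , []))
                              (4 + length (reverse xs) * (35 + B))
    loop = subst (λ zs → Runs (foldrLoop C) (enc (G ⊗ S ⊗ list A) (g , s₀ , reverse xs))
                                            (enc (G ⊗ S ⊗ list A) (g , foldr h s₀ zs , []))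
                                            (4 + length (reverse xs) * (35 + B)))
             (reverse-involutive xs)
             (foldr-loop (reverse xs) [] (subst StepsRun (sym (reverse-involutive xs)) r))
    arith : ∀ n B → 17 + n * 10 + (4 + n * (35 + B) + 4) ≡ 25 + n * (45 + B)
    arith = solve-∀
    bound : 17 + length xs * 10 + (4 + length (reverse xs) * (35 + B) + 4) ≤ 30 + length xs * (50 + B)
    bound = begin
      17 + length xs * 10 + (4 + length (reverse xs) * (35 + B) + 4)
        ≡⟨ cong (λ n → 17 + length xs * 10 + (4 + n * (35 + B) + 4)) (length-reverse xs) ⟩
      17 + length xs * 10 + (4 + length xs * (35 + B) + 4)
        ≡⟨ arith (length xs) B ⟩
      25 + length xs * (45 + B)
        ≤⟨ +-mono-≤ (m≤m+n 25 5) (*-monoʳ-≤ (length xs) (+-monoˡ-≤ B (m≤m+n 45 5))) ⟩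
      30 + length xs * (50 + B) ∎

-- Programs for any, append and concatMap

private variable
  A B G S U : Ty

withEnv : Cmd → Cmd
withEnv C = 0 ≔ `cons (`hd (var 0)) (`hd (`tl (var 0))) ⨟ C

runs-withEnv : ∀ {a x s b t} → Runs C (a ∙ x) b t → Runs (withEnv C) (a ∙ x ∙ s) b (7 + t)
runs-withEnv r = runs-seq
  (runs-assign _ λ σ e → cong (λ t → head t ∙ head (tail t)) e) r

anyCmd : Cmd → Cmd
anyCmd C =
  0 ≔ `cons (`hd (var 0)) (`cons `nil (`tl (var 0))) ⨟
  foldrCmd (ifCmd (withEnv C) (0 ≔ `cons `nil `nil) (0 ≔ `tl (`tl (var 0))))

any-foldr : ∀ {X : Set} (h : X → Bool) xs →
  foldr (λ x s → if h x then true else s) false xs ≡ any h xs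
any-foldr h []       = refl
any-foldr h (x ∷ xs) with h x
... | true  = refl
... | false = any-foldr h xs

-- The bound `b` concerns a single test, which makes the total linear in the number of entries. In
-- this form it is applied to the list of all guesses.
runs-any : ∀ {b} {g : ⟦ G ⟧} (h : ⟦ A ⟧ → Bool) {xs} →
  All (λ x → Runs C (enc (G ⊗ A) (g , x)) (encodeBool (h x)) b) xs →
  Runs (anyCmd C) (enc (G ⊗ list A) (g , xs)) (encodeBool (any h xs))
       (50 + length xs * (100 + b))
runs-any {G = G} {A = A} {C = C} {b = b} {g = g} h {xs} rs =
  runs-≤ bound (runs-seq
    (runs-assign _ λ σ e → cong (λ t → head t ∙ nil ∙ tail t) e)
    (subst (λ v → Runs _ _ (encodeBool v) _) (any-foldr h xs)
      (runs-foldr {S = bool} g (λ x s → if h x then true else s) false b′ xs (steps rs))))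
  where
  b′ : ℕ
  b′ = 20 + (7 + b + (4 + 4))
  step : ∀ x s → Runs C (enc (G ⊗ A) (g , x)) (encodeBool (h x)) b →
    Runs (ifCmd (withEnv C) (0 ≔ `cons `nil `nil) (0 ≔ `tl (`tl (var 0))))
         (enc (G ⊗ A ⊗ bool) (g , x , s)) (encodeBool (if h x then true else s))
         b′
  step x s r = runs-if (h x) (runs-withEnv r)
    (λ eq → runs-assign _ λ σ e → cong (λ v → encodeBool (if v then true else s)) (sym eq))
    (λ eq → runs-assign _ λ σ e → trans (cong (λ t → tail (tail t)) e)
                                        (cong (λ v → encodeBool (if v then true else s)) (sym eq)))
  steps : ∀ {xs} → All (λ x → Runs C (enc (G ⊗ A) (g , x)) (encodeBool (h x)) b) xs →
          StepsRun {G = G} {S = bool} g (λ x s → if h x then true else s) false b′ xs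
  steps []       = tt
  steps (r ∷ rs) = step _ _ r , steps rs
  bound : 8 + (30 + length xs * (50 + (20 + (7 + b + (4 + 4))))) ≤ 50 + length xs * (100 + b)
  bound = +-mono-≤ (m≤m+n 38 12) (*-monoʳ-≤ (length xs)
    (≤-trans (≤-reflexive (arith b)) (+-monoˡ-≤ b (m≤m+n 85 15))))
    where
    arith : ∀ b → 50 + (20 + (7 + b + (4 + 4))) ≡ 85 + b
    arith = solve-∀

appendCmd : Cmd
appendCmd = 0 ≔ `cons `nil (var 0) ⨟ foldrCmd (0 ≔ `tl (var 0))

runs-append : ∀ (xs ys : List ⟦ A ⟧) →
  Runs appendCmd (enc (list A ⊗ list A) (ys , xs)) (enc (list A) (xs ++ ys))
       (40 + length xs * 60)
runs-append {A = A} xs ys = runs-≤ bound (runs-seq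
  (runs-assign _ λ σ e → cong (nil ∙_) e)
  (subst (λ zs → Runs (foldrCmd (0 ≔ `tl (var 0))) (nil ∙ enc (list A ⊗ list A) (ys , xs))
                      (enc (list A) zs) (30 + length xs * (50 + 3)))
    (sym (++-is-foldr xs ys))
    (runs-foldr {G = unit} {S = list A} tt _∷_ ys 3 xs (steps xs))))
  where
  steps : ∀ xs → StepsRun {G = unit} {S = list A} {C = 0 ≔ `tl (var 0)} tt _∷_ ys 3 xs
  steps []       = tt
  steps (x ∷ xs) = runs-assign _ (λ σ e → cong tail e) , steps xs
  bound : 4 + (30 + length xs * (50 + 3)) ≤ 40 + length xs * 60
  bound = +-mono-≤ (m≤m+n 34 6) (*-monoʳ-≤ (length xs) (m≤m+n 53 7))

concatMapCmd : Cmd → Cmd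
concatMapCmd C =
  0 ≔ `cons (`hd (var 0)) (`cons `nil (`tl (var 0))) ⨟
  foldrCmd (pairCmd (0 ≔ `tl (`tl (var 0))) (withEnv C) ⨟ appendCmd)

concatMap-foldr : ∀ {X Y : Set} (h : X → List Y) xs →
  foldr (λ x ys → h x ++ ys) [] xs ≡ concatMap h xs
concatMap-foldr h []       = refl
concatMap-foldr h (x ∷ xs) = cong (h x ++_) (concatMap-foldr h xs)

-- Appending walks along `h x` only and shares the accumulated output, so the length of that output
-- does not enter the cost; `ℓ` bounds the walk.
runs-concatMap : ∀ {b ℓ} {g : ⟦ G ⟧} (h : ⟦ A ⟧ → List ⟦ B ⟧) {xs} →
  All (λ x → Runs C (enc (G ⊗ A) (g , x)) (enc (list B) (h x)) b × length (h x) ≤ ℓ) xs →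
  Runs (concatMapCmd C) (enc (G ⊗ list A) (g , xs)) (enc (list B) (concatMap h xs))
       (50 + length xs * (200 + b + ℓ * 60))
runs-concatMap {G = G} {A = A} {B = B} {C = C} {b = b} {ℓ = ℓ} {g = g} h {xs} rs =
  runs-≤ bound (runs-seq
    (runs-assign _ λ σ e → cong (λ t → head t ∙ nil ∙ tail t) e)
    (subst (λ ys → Runs (foldrCmd step) (enc (G ⊗ list B ⊗ list A) (g , [] , xs))
                        (enc (list B) ys) (30 + length xs * (50 + b′)))
      (concatMap-foldr h xs)
      (runs-foldr {S = list B} g (λ x ys → h x ++ ys) [] b′ xs (steps rs))))
  where
  step : Cmd
  step = pairCmd (0 ≔ `tl (`tl (var 0))) (withEnv C) ⨟ appendCmd
  b′ : ℕ
  b′ = (28 + (4 + (7 + b))) + (40 + ℓ * 60)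
  steps : ∀ {xs} →
    All (λ x → Runs C (enc (G ⊗ A) (g , x)) (enc (list B) (h x)) b × length (h x) ≤ ℓ) xs →
    StepsRun {G = G} {S = list B} {C = step} g (λ x ys → h x ++ ys) [] b′ xs
  steps []                       = tt
  steps {x ∷ xs} ((r , ≤ℓ) ∷ rs) =
    runs-≤ (+-monoʳ-≤ (28 + (4 + (7 + b))) (+-monoʳ-≤ 40 (*-monoˡ-≤ 60 ≤ℓ)))
      (runs-seq
        (runs-pair (runs-assign _ (λ σ e → cong (λ t → tail (tail t)) e)) (runs-withEnv r))
        (runs-append {A = B} (h x) _)) ,
    steps rs
  bound : 8 + (30 + length xs * (50 + b′)) ≤ 50 + length xs * (200 + b + ℓ * 60)
  bound = +-mono-≤ (m≤m+n 38 12) (*-monoʳ-≤ (length xs)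
    (≤-trans (≤-reflexive (arith b (ℓ * 60))) (+-monoˡ-≤ (ℓ * 60) (+-monoˡ-≤ b (m≤m+n 129 71)))))
    where
    arith : ∀ b ℓ → 50 + ((28 + (4 + (7 + b))) + (40 + ℓ)) ≡ 129 + b + ℓ
    arith = solve-∀

-- Sizes of encodings

sz : ∀ A → ⟦ A ⟧ → ℕ
sz A a = size (enc A a)

size-head : ∀ t → size (head t) ≤ size t
size-head nil     = ≤-refl
size-head (l ∙ r) = m≤n⇒m≤1+n (m≤m+n (size l) (size r))

size-tail : ∀ t → size (tail t) ≤ size t
size-tail nil     = ≤-refl
size-tail (l ∙ r) = m≤n⇒m≤1+n (m≤n+m (size r) (size l))

length≤sz : ∀ A xs → length xs ≤ sz (list A) xs
length≤sz A []       = z≤n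
length≤sz A (x ∷ xs) = s≤s (≤-trans (length≤sz A xs) (m≤n+m _ (sz A x)))

sz-++ : ∀ A xs ys → sz (list A) (xs ++ ys) ≤ sz (list A) xs + sz (list A) ys
sz-++ A []       ys = n≤1+n _
sz-++ A (x ∷ xs) ys = s≤s (begin
  sz A x + sz (list A) (xs ++ ys)               ≤⟨ +-monoʳ-≤ (sz A x) (sz-++ A xs ys) ⟩
  sz A x + (sz (list A) xs + sz (list A) ys)    ≡⟨ +-assoc (sz A x) _ _ ⟨
  sz A x + sz (list A) xs + sz (list A) ys      ∎)
  where open ≤-Reasoning

sz-concatMap : ∀ {X : Set} A (h : X → List ⟦ A ⟧) {m xs} → All (λ x → sz (list A) (h x) ≤ m) xs →
  sz (list A) (concatMap h xs) ≤ 1 + length xs * m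
sz-concatMap A h []                 = ≤-refl
sz-concatMap A h {m} {x ∷ xs} (p ∷ ps) = begin
  sz (list A) (h x ++ concatMap h xs)            ≤⟨ sz-++ A (h x) _ ⟩
  sz (list A) (h x) + sz (list A) (concatMap h xs) ≤⟨ +-mono-≤ p (sz-concatMap A h ps) ⟩
  m + (1 + length xs * m)                        ≡⟨ +-suc m _ ⟩
  1 + (m + length xs * m)                        ∎
  where open ≤-Reasoning

sz-filterᵇ : ∀ A p xs → sz (list A) (filterᵇ p xs) ≤ sz (list A) xs
sz-filterᵇ A p []       = ≤-refl
sz-filterᵇ A p (x ∷ xs) with p x
... | true  = s≤s (+-monoʳ-≤ (sz A x) (sz-filterᵇ A p xs))
... | false = m≤n⇒m≤1+n (≤-trans (sz-filterᵇ A p xs) (m≤n+m _ (sz A x)))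

sz-elements : ∀ G A (g : ⟦ G ⟧) xs → All (λ x → sz (G ⊗ A) (g , x) ≤ sz (G ⊗ list A) (g , xs)) xs
sz-elements G A g []       = []
sz-elements G A g (x ∷ xs) =
  s≤s (+-monoʳ-≤ (sz G g) (m≤n⇒m≤1+n (m≤m+n _ _))) ∷
  All.map (λ le → ≤-trans le (s≤s (+-monoʳ-≤ (sz G g) (m≤n⇒m≤1+n (m≤n+m _ (sz A x))))))
    (sz-elements G A g xs)

-- Polynomial time

-- `grow` is recorded because in a composition the time of the outer program depends on the size of
-- the intermediate result.
record PTime (A B : Ty) (f : ⟦ A ⟧ → ⟦ B ⟧) : Set where
  field
    code      : Cmd
    time grow : Poly
    runs      : ∀ a → Runs code (enc A a) (enc B (f a)) (⟪ time ⟫ (sz A a))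
    grows     : ∀ a → sz B (f a) ≤ ⟪ grow ⟫ (sz A a)

open PTime

resp : ∀ {f g : ⟦ A ⟧ → ⟦ B ⟧} → (∀ a → f a ≡ g a) → PTime A B f → PTime A B g
resp {A = A} {B = B} eq F = record
  { code  = code F
  ; time  = time F
  ; grow  = grow F
  ; runs  = λ a → subst (λ b → Runs (code F) (enc A a) (enc B b) (⟪ time F ⟫ (sz A a))) (eq a) (runs F a)
  ; grows = λ a → subst (λ b → sz B b ≤ ⟪ grow F ⟫ (sz A a)) (eq a) (grows F a)
  }

shrink : ∀ e (f : ⟦ A ⟧ → ⟦ B ⟧) → (∀ σ a → σ 0 ≡ enc A a → eval e σ ≡ enc B (f a)) →
         (∀ a → sz B (f a) ≤ sz A a) → PTime A B f
shrink e f ev le = record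
  { code  = 0 ≔ e
  ; time  = con (suc (cost e))
  ; grow  = ι
  ; runs  = λ a → runs-assign e (λ σ → ev σ a)
  ; grows = le
  }

-- Several types share their encodings: pairs and nonempty lists, numerals and lists of units,
-- colours and their numbers. The identity program converts between them.
cast : (f : ⟦ A ⟧ → ⟦ B ⟧) → (∀ a → enc A a ≡ enc B (f a)) → PTime A B f
cast f eq = shrink (var 0) f (λ σ a e → trans e (eq a)) (λ a → ≤-reflexive (cong size (sym (eq a))))

idP : PTime A A id
idP = cast id λ _ → refl

fstP : PTime (A ⊗ B) A proj₁
fstP {A = A} = shrink (`hd (var 0)) proj₁ (λ σ a → cong head) (λ (a , b) → size-head (enc A a ∙ _))

sndP : PTime (A ⊗ B) B proj₂
sndP {A = A} = shrink (`tl (var 0)) proj₂ (λ σ a → cong tail) (λ (a , b) → size-tail (enc A a ∙ _))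

consP : PTime (A ⊗ list A) (list A) λ (x , xs) → x ∷ xs
consP = cast _ λ _ → refl

quoteTree : Tree → Expr
quoteTree nil     = `nil
quoteTree (l ∙ r) = `cons (quoteTree l) (quoteTree r)

eval-quoteTree : ∀ t σ → eval (quoteTree t) σ ≡ t
eval-quoteTree nil     σ = refl
eval-quoteTree (l ∙ r) σ = cong₂ _∙_ (eval-quoteTree l σ) (eval-quoteTree r σ)

constP : ∀ b → PTime A B (const b)
constP {B = B} b = record
  { code  = 0 ≔ quoteTree (enc B b)
  ; time  = con (suc (cost (quoteTree (enc B b))))
  ; grow  = con (sz B b)
  ; runs  = λ a → runs-assign _ λ σ e → eval-quoteTree (enc B b) σ
  ; grows = λ a → ≤-refl
  }

infixr 9 _∘P_

_∘P_ : ∀ {g : ⟦ B ⟧ → ⟦ U ⟧} {f : ⟦ A ⟧ → ⟦ B ⟧} → PTime B U g → PTime A B f → PTime A U (g ∘ f)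
F′ ∘P F = record
  { code  = code F ⨟ code F′
  ; time  = time F ⊕ time F′ ⊚ grow F
  ; grow  = grow F′ ⊚ grow F
  ; runs  = λ a → runs-≤ (+-monoʳ-≤ _ (poly-mono (time F′) (grows F a)))
                    (runs-seq (runs F a) (runs F′ _))
  ; grows = λ a → ≤-trans (grows F′ _) (poly-mono (grow F′) (grows F a))
  }

⟨_,_⟩P : ∀ {f : ⟦ A ⟧ → ⟦ B ⟧} {g : ⟦ A ⟧ → ⟦ U ⟧} → PTime A B f → PTime A U g → PTime A (B ⊗ U) λ a → f a , g a
⟨ F , F′ ⟩P = record
  { code  = pairCmd (code F) (code F′)
  ; time  = con 28 ⊕ (time F ⊕ time F′)
  ; grow  = con 1 ⊕ (grow F ⊕ grow F′)
  ; runs  = λ a → runs-pair (runs F a) (runs F′ a)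
  ; grows = λ a → s≤s (+-mono-≤ (grows F a) (grows F′ a))
  }

ifP : ∀ {h : ⟦ A ⟧ → Bool} {f g : ⟦ A ⟧ → ⟦ B ⟧} →
  PTime A bool h → PTime A B f → PTime A B g → PTime A B λ a → if h a then f a else g a
ifP {A = A} {B = B} {h = h} {f = f} {g = g} H F F′ = record
  { code  = ifCmd (code H) (code F) (code F′)
  ; time  = con 20 ⊕ (time H ⊕ (time F ⊕ time F′))
  ; grow  = grow F ⊕ grow F′
  ; runs  = λ a → runs-if (h a) (runs H a)
      (λ eq → subst (λ v → Runs (code F) (enc A a) (enc B (if v then f a else g a)) (⟪ time F ⟫ (sz A a)))
                    (sym eq) (runs F a))
      (λ eq → subst (λ v → Runs (code F′) (enc A a) (enc B (if v then f a else g a)) (⟪ time F′ ⟫ (sz A a)))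
                    (sym eq) (runs F′ a))
  ; grows = λ a → case a (h a)
  }
  where
  case : ∀ a v → sz B (if v then f a else g a) ≤ ⟪ grow F ⟫ (sz A a) + ⟪ grow F′ ⟫ (sz A a)
  case a true  = ≤-trans (grows F a) (m≤m+n _ _)
  case a false = ≤-trans (grows F′ a) (m≤n+m _ _)

-- Iterating a step of polynomial growth can blow up exponentially, so a bound `r` on the result has
-- to be supplied. For an input of size `N` the argument of every step then has size at most
-- `N + ⟪ r ⟫ N`.
foldrP : ∀ {h : ⟦ G ⟧ × ⟦ A ⟧ × ⟦ S ⟧ → ⟦ S ⟧} → PTime (G ⊗ A ⊗ S) S h →
  (r : Poly) →
  (∀ g s xs → sz S (foldr (λ x s → h (g , x , s)) s xs) ≤ ⟪ r ⟫ (sz (G ⊗ S ⊗ list A) (g , s , xs))) →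
  PTime (G ⊗ S ⊗ list A) S λ (g , s , xs) → foldr (λ x s → h (g , x , s)) s xs
foldrP {G = G} {A = A} {S = S} {h = h} H r bound = record
  { code  = foldrCmd (code H)
  ; time  = con 30 ⊕ ι ⊛ (con 50 ⊕ time H ⊚ (ι ⊕ r))
  ; grow  = r
  ; runs  = λ (g , s , xs) → runs-≤
      (+-monoʳ-≤ 30 (*-monoˡ-≤ _ (≤-trans (length≤sz A xs)
        (m≤n⇒m≤1+n (≤-trans (m≤n⇒m≤1+n (m≤n+m _ (sz S s))) (m≤n+m _ (sz G g)))))))
      (runs-foldr g _ s _ xs (steps g s _ xs ≤-refl))
  ; grows = λ (g , s , xs) → bound g s xs
  }
  where
  steps : ∀ g s N xs → sz (G ⊗ S ⊗ list A) (g , s , xs) ≤ N →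
          StepsRun {G = G} {S = S} {C = code H} g (λ x s → h (g , x , s)) s (⟪ time H ⟫ (N + ⟪ r ⟫ N)) xs
  steps g s N []       ≤N = tt
  steps g s N (x ∷ xs) ≤N =
    runs-≤ (poly-mono (time H) (begin
      1 + (sz G g + (1 + (sz A x + s′)))             ≡⟨ arith (sz G g) (sz A x) s′ ⟩
      1 + (sz G g + (1 + sz A x)) + s′               ≤⟨ +-monoˡ-≤ s′ (s≤s (+-monoʳ-≤ (sz G g)
                                                          (≤-trans (s≤s (m≤m+n (sz A x) _))
                                                          (≤-trans (m≤n+m _ (sz S s)) (n≤1+n _))))) ⟩
      sz (G ⊗ S ⊗ list A) (g , s , x ∷ xs) + s′      ≤⟨ +-mono-≤ ≤N (≤-trans (bound g s xs) (poly-mono r ≤N′)) ⟩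
      N + ⟪ r ⟫ N                                    ∎))
      (runs H (g , x , foldr (λ x s → h (g , x , s)) s xs)) ,
    steps g s N xs ≤N′
    where
    open ≤-Reasoning
    s′ : ℕ
    s′ = sz S (foldr (λ x s → h (g , x , s)) s xs)
    ≤N′ : sz (G ⊗ S ⊗ list A) (g , s , xs) ≤ N
    ≤N′ = ≤-trans (s≤s (+-monoʳ-≤ (sz G g) (s≤s (+-monoʳ-≤ (sz S s) (m≤n⇒m≤1+n (m≤n+m _ (sz A x))))))) ≤N
    arith : ∀ a b c → 1 + (a + (1 + (b + c))) ≡ 1 + (a + (1 + b)) + c
    arith = solve-∀

anyP : ∀ {h : ⟦ G ⟧ × ⟦ A ⟧ → Bool} → PTime (G ⊗ A) bool h →
  PTime (G ⊗ list A) bool λ (g , xs) → any (λ x → h (g , x)) xs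
anyP {G = G} {A = A} {h = h} H = record
  { code  = anyCmd (code H)
  ; time  = con 50 ⊕ ι ⊛ (con 100 ⊕ time H)
  ; grow  = con 3
  ; runs  = λ (g , xs) → runs-≤
      (+-monoʳ-≤ 50 (*-monoˡ-≤ _ (≤-trans (length≤sz A xs) (size-tail (enc G g ∙ _)))))
      (runs-any {G = G} {A = A} _
        (All.map (λ {x} le → runs-≤ (poly-mono (time H) le) (runs H (g , x))) (sz-elements G A g xs)))
  ; grows = λ (g , xs) → size-encodeBool (any (λ x → h (g , x)) xs)
  }
  where
  size-encodeBool : ∀ v → size (encodeBool v) ≤ 3
  size-encodeBool false = s≤s z≤n
  size-encodeBool true  = ≤-refl

concatMapP : ∀ {h : ⟦ G ⟧ × ⟦ A ⟧ → List ⟦ B ⟧} → PTime (G ⊗ A) (list B) h →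
  PTime (G ⊗ list A) (list B) λ (g , xs) → concatMap (λ x → h (g , x)) xs
concatMapP {G = G} {A = A} {B = B} {h = h} H = record
  { code  = concatMapCmd (code H)
  ; time  = con 50 ⊕ ι ⊛ (con 200 ⊕ time H ⊕ grow H ⊛ con 60)
  ; grow  = con 1 ⊕ ι ⊛ grow H
  ; runs  = λ (g , xs) → runs-≤
      (+-monoʳ-≤ 50 (*-monoˡ-≤ _ (length≤ g xs)))
      (runs-concatMap {G = G} {A = A} {B = B} _
        (All.map (λ {x} le → runs-≤ (poly-mono (time H) le) (runs H (g , x)) ,
                             ≤-trans (length≤sz B (h (g , x))) (≤-trans (grows H (g , x)) (poly-mono (grow H) le)))
                 (sz-elements G A g xs)))
  ; grows = λ (g , xs) → ≤-trans
      (sz-concatMap B _ (All.map (λ {x} le → ≤-trans (grows H (g , x)) (poly-mono (grow H) le))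
                                 (sz-elements G A g xs)))
      (s≤s (*-monoˡ-≤ _ (length≤ g xs)))
  }
  where
  length≤ : ∀ g xs → length xs ≤ sz (G ⊗ list A) (g , xs)
  length≤ g xs = ≤-trans (length≤sz A xs) (size-tail (enc G g ∙ _))

-- The algorithm

Colour Lit Rel : Set
Colour = Fin 3
Lit    = ℕ × Colour
Rel    = List (Lit × Lit)

pattern colA = zero
pattern colS = suc zero
pattern colB = suc (suc zero)

colours : List Colour
colours = colA ∷ colS ∷ colB ∷ []

headOr : ∀ {A : Set} → A → List A → A
headOr d []      = d
headOr d (x ∷ _) = x

nth : ∀ {A : Set} → A → List A → ℕ → A
nth d xs i = headOr d (drop i xs)

adjacent : List (List Bool) → ℕ → ℕ → Bool
adjacent M u v = nth false (nth [] M u) v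

-- With A = 0, S = 1 and B = 2, the colour pairs forbidden on an edge are those of sum 2.
compat : List (List Bool) → Lit × Lit → Bool
compat M ((u , c) , (v , d)) =
  (if u ≡ᵇ v then toℕ c ≡ᵇ toℕ d else true) ∧
  (if adjacent M u v then not (toℕ c ≡ᵇ 2 ∸ toℕ d) else true)

literals : List ℕ → List Lit
literals vs = cartesianProduct vs colours

allowed : List (List Bool) → List ℕ → Rel
allowed M vs = filterᵇ (compat M) (cartesianProduct (literals vs) (literals vs))

eqLit : Lit → Lit → Bool
eqLit (u , c) (v , d) = (u ≡ᵇ v) ∧ (toℕ c ≡ᵇ toℕ d)

eqPair : Lit × Lit → Lit × Lit → Bool
eqPair (p , q) (p′ , q′) = eqLit p p′ ∧ eqLit q q′

mem : Lit × Lit → Rel → Bool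
mem pq P = any (eqPair pq) P

-- The list `E` serves two purposes: all colours give elimination of `w`, a single colour gives the
-- guess of the colour of `w`. The loop at `(w , e)` is tested because a literal may already have
-- been ruled out by itself.
elim : ℕ → List Colour → Rel → Rel
elim w E P = filterᵇ
  (λ (p , q) → any (λ e → mem (p , w , e) P ∧ mem ((w , e) , w , e) P ∧ mem ((w , e) , q) P) E) P

elimAll : List ℕ → Rel → Rel
elimAll vs P = foldr (λ w → elim w colours) P vs

-- The loops are tested as well, so that the two literals form a `Clique`, from which the
-- reconstruction of a solution starts.
accept : Rel → Bool
accept P = any (λ ((u , c) , (v , d)) →
  (toℕ c ≡ᵇ 0) ∧ (toℕ d ≡ᵇ 2) ∧ mem ((u , c) , (u , c)) P ∧ mem ((v , d) , (v , d)) P) P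

split : ℕ → Rel → List Rel
split x P = map (λ c → elim x (c ∷ []) P) colours

branches : List ℕ → List Rel → List Rel
branches xs Ps = foldr (λ x → concatMap (split x)) Ps xs

vertices : List (List Bool) → List ℕ
vertices M = downFrom (length M)

chosen : List (List Bool) → List Bool → List ℕ
chosen M X = filterᵇ (nth false X) (vertices M)

decide : List (List Bool) → List Bool → Bool
decide M X =
  any (λ P → accept (elimAll (vertices M) P))
      (branches (chosen M X) (allowed M (vertices M) ∷ []))

-- Lists and arithmetic in polynomial time

andP : ∀ {f g : ⟦ A ⟧ → Bool} → PTime A bool f → PTime A bool g → PTime A bool λ a → f a ∧ g a
andP {f = f} {g = g} F G = resp (λ a → lemma (f a) (g a)) (ifP F G (constP false))
  where
  lemma : ∀ x y → (if x then y else false) ≡ x ∧ y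
  lemma false y = refl
  lemma true  y = refl

notP : ∀ {f : ⟦ A ⟧ → Bool} → PTime A bool f → PTime A bool λ a → not (f a)
notP {f = f} F = resp (λ a → lemma (f a)) (ifP F (constP false) (constP true))
  where
  lemma : ∀ x → (if x then false else true) ≡ not x
  lemma false = refl
  lemma true  = refl

filterP : ∀ {h : ⟦ G ⟧ × ⟦ A ⟧ → Bool} → PTime (G ⊗ A) bool h →
  PTime (G ⊗ list A) (list A) λ (g , xs) → filterᵇ (λ x → h (g , x)) xs
filterP {h = h} H = resp (λ (g , xs) → lemma (λ x → h (g , x)) xs)
  (concatMapP (ifP H (consP ∘P ⟨ sndP , constP [] ⟩P) (constP [])))
  where
  lemma : ∀ {X : Set} (p : X → Bool) xs →
    concatMap (λ x → if p x then x ∷ [] else []) xs ≡ filterᵇ p xs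
  lemma p []       = refl
  lemma p (x ∷ xs) with p x
  ... | true  = cong (x ∷_) (lemma p xs)
  ... | false = lemma p xs

mapP : ∀ {h : ⟦ G ⟧ × ⟦ A ⟧ → ⟦ B ⟧} → PTime (G ⊗ A) B h →
  PTime (G ⊗ list A) (list B) λ (g , xs) → map (λ x → h (g , x)) xs
mapP {h = h} H = resp (λ (g , xs) → lemma (λ x → h (g , x)) xs)
  (concatMapP (consP ∘P ⟨ H , constP [] ⟩P))
  where
  lemma : ∀ {X Y : Set} (f : X → Y) xs → concatMap (λ x → f x ∷ []) xs ≡ map f xs
  lemma f []       = refl
  lemma f (x ∷ xs) = cong (f x ∷_) (lemma f xs)

productP : PTime (list A ⊗ list B) (list (A ⊗ B)) λ (xs , ys) → cartesianProduct xs ys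
productP {A = A} {B = B} = resp (λ (xs , ys) → lemma xs ys)
  (concatMapP (mapP ⟨ sndP ∘P fstP , sndP ⟩P ∘P ⟨ idP , fstP ⟩P) ∘P ⟨ sndP , fstP ⟩P)
  where
  lemma : ∀ {X Y : Set} (xs : List X) (ys : List Y) →
    concatMap (λ x → map (λ y → x , y) ys) xs ≡ cartesianProduct xs ys
  lemma []       ys = refl
  lemma (x ∷ xs) ys = cong (map (x ,_) ys ++_) (lemma xs ys)

unitsP : PTime nat (list unit) λ n → replicate n tt
unitsP = cast _ lemma
  where
  lemma : ∀ n → encodeℕ n ≡ enc (list unit) (replicate n tt)
  lemma zero    = refl
  lemma (suc n) = cong (nil ∙_) (lemma n)

iterate : ∀ {S : Set} → (S → S) → S → ℕ → S
iterate f s n = foldr (λ _ → f) s (replicate n tt)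

iterateP : ∀ {f : ⟦ S ⟧ → ⟦ S ⟧} → PTime S S f → (∀ s → sz S (f s) ≤ sz S s) →
  PTime (S ⊗ nat) S λ (s , n) → iterate f s n
iterateP {S = S} {f = f} F le =
  foldrP (F ∘P sndP ∘P sndP) ι (λ g s xs → bound s xs) ∘P
  ⟨ constP {B = unit} tt , ⟨ fstP , unitsP ∘P sndP ⟩P ⟩P
  where
  shrinks : ∀ s xs → sz S (foldr (λ _ → f) s xs) ≤ sz S s
  shrinks s []       = ≤-refl
  shrinks s (x ∷ xs) = ≤-trans (le _) (shrinks s xs)
  bound : ∀ s xs → sz S (foldr (λ _ → f) s xs) ≤ sz (unit ⊗ S ⊗ list unit) (tt , s , xs)
  bound s xs = ≤-trans (shrinks s xs) (m≤n⇒m≤1+n (m≤n⇒m≤1+n (m≤n⇒m≤1+n (m≤m+n _ _))))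

tailP : PTime (list A) (list A) (drop 1)
tailP {A = A} = shrink (`tl (var 0)) (drop 1)
  (λ { σ [] e → cong tail e ; σ (x ∷ xs) e → cong tail e })
  (λ { [] → ≤-refl ; (x ∷ xs) → size-tail (enc (list A) (x ∷ xs)) })

dropP : PTime (list A ⊗ nat) (list A) λ (xs , n) → drop n xs
dropP {A = A} = resp (λ (xs , n) → lemma n xs) (iterateP {S = list A} tailP
  λ { [] → ≤-refl ; (x ∷ xs) → size-tail (enc (list A) (x ∷ xs)) })
  where
  drop-suc : ∀ {X : Set} n (xs : List X) → drop 1 (drop n xs) ≡ drop (suc n) xs
  drop-suc zero    xs       = refl
  drop-suc (suc n) []       = refl
  drop-suc (suc n) (x ∷ xs) = drop-suc n xs
  lemma : ∀ {X : Set} n (xs : List X) → iterate (drop 1) xs n ≡ drop n xs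
  lemma zero    xs = refl
  lemma (suc n) xs = trans (cong (drop 1) (lemma n xs)) (drop-suc n xs)

-- The head of nil is nil, which has to encode the default element.
headOrP : ∀ d → enc A d ≡ nil → PTime (list A) A (headOr d)
headOrP {A = A} d eq = shrink (`hd (var 0)) (headOr d)
  (λ { σ [] e → trans (cong head e) (sym eq) ; σ (x ∷ xs) e → cong head e })
  (λ { [] → ≤-reflexive (cong size eq) ; (x ∷ xs) → size-head (enc (list A) (x ∷ xs)) })

nthP : ∀ d → enc A d ≡ nil → PTime (list A ⊗ nat) A λ (xs , i) → nth d xs i
nthP d eq = headOrP d eq ∘P dropP

predP : PTime nat nat pred
predP = shrink (`tl (var 0)) pred
  (λ { σ zero e → cong tail e ; σ (suc n) e → cong tail e })
  (λ { zero → ≤-refl ; (suc n) → size-tail (encodeℕ (suc n)) })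

monusP : PTime (nat ⊗ nat) nat λ (m , n) → m ∸ n
monusP = resp (λ (m , n) → lemma m n) (iterateP predP
  λ { zero → ≤-refl ; (suc n) → size-tail (encodeℕ (suc n)) })
  where
  lemma : ∀ m n → iterate pred m n ≡ m ∸ n
  lemma m zero    = refl
  lemma m (suc n) = trans (cong pred (lemma m n)) (pred[m∸n]≡m∸[1+n] m n)

isPositive : ℕ → Bool
isPositive n = any (λ _ → true) (replicate n tt)

isPositiveP : PTime nat bool isPositive
isPositiveP = anyP (constP {A = unit ⊗ unit} true) ∘P ⟨ constP tt , unitsP ⟩P

-- The only primitive test is against `nil`, so equality is reduced to truncated subtraction in both
-- directions.
eqℕP : PTime (nat ⊗ nat) bool λ (m , n) → m ≡ᵇ n
eqℕP = resp (λ (m , n) → lemma m n)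
  (ifP (isPositiveP ∘P monusP) (constP false)
       (notP (isPositiveP ∘P monusP ∘P ⟨ sndP , fstP ⟩P)))
  where
  lemma : ∀ m n → (if isPositive (m ∸ n) then false else not (isPositive (n ∸ m))) ≡ (m ≡ᵇ n)
  lemma zero    zero    = refl
  lemma zero    (suc n) = refl
  lemma (suc m) zero    = refl
  lemma (suc m) (suc n) = lemma m n

toℕP : PTime col nat toℕ
toℕP = cast toℕ λ _ → refl

sucP : PTime nat nat suc
sucP = cast {A = unit ⊗ nat} (λ (_ , n) → suc n) (λ _ → refl) ∘P ⟨ constP tt , idP ⟩P

-- Counting starts from the list [ 0 ], which is dropped in the end.
verticesP : PTime (list (list bool)) (list nat) vertices
verticesP = resp (λ M → cong (drop 1) (lemma M)) (tailP ∘P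
  foldrP {G = unit} step (ι ⊕ ι ⊛ (con 1 ⊕ ι ⊕ con 2 ⊛ ι))
    (λ g s xs → ≤-trans (bound s xs) (mono s xs)) ∘P
  ⟨ constP tt , ⟨ constP (0 ∷ []) , idP ⟩P ⟩P)
  where
  next : List ℕ → List ℕ
  next vs = suc (headOr 0 vs) ∷ vs
  step : PTime (unit ⊗ list bool ⊗ list nat) (list nat) λ (_ , _ , vs) → next vs
  step = consP ∘P ⟨ sucP ∘P headOrP 0 refl ∘P sndP ∘P sndP , sndP ∘P sndP ⟩P
  count : List ℕ → List (List Bool) → List ℕ
  count = foldr (λ _ → next)
  lemma : ∀ M → count (0 ∷ []) M ≡ downFrom (suc (length M))
  lemma []      = refl
  lemma (_ ∷ M) = cong next (lemma M)
  -- A successor enlarges the encoding of a number by 2, whence the slope 2.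
  headBound : ∀ s M → sz nat (headOr 0 (count s M)) ≤ sz (list nat) s + 2 * length M
  headBound []      []      = s≤s z≤n
  headBound (v ∷ s) []      = ≤-trans (size-head (enc (list nat) (v ∷ s))) (m≤m+n _ _)
  headBound s       (_ ∷ M) = ≤-trans (+-monoʳ-≤ 2 (headBound s M)) (≤-reflexive (arith (sz (list nat) s) (length M)))
    where
    arith : ∀ a n → 2 + (a + 2 * n) ≡ a + 2 * suc n
    arith = solve-∀
  bound : ∀ s M → sz (list nat) (count s M) ≤
    sz (list nat) s + length M * (1 + sz (list nat) s + 2 * length M)
  bound s []      = m≤m+n _ _
  bound s (_ ∷ M) = begin
    1 + (2 + sz nat (headOr 0 (count s M)) + sz (list nat) (count s M))
      ≤⟨ s≤s (+-mono-≤ (+-monoʳ-≤ 2 (headBound s M)) (bound s M)) ⟩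
    1 + (2 + (m + 2 * n) + (m + n * (1 + m + 2 * n)))
      ≡⟨ arith m n ⟩
    m + ((1 + m + 2 * suc n) + n * (1 + m + 2 * n))
      ≤⟨ +-monoʳ-≤ m (+-monoʳ-≤ (1 + m + 2 * suc n) (*-monoʳ-≤ n (+-monoʳ-≤ (1 + m) (*-monoʳ-≤ 2 (n≤1+n n))))) ⟩
    m + suc n * (1 + m + 2 * suc n) ∎
    where
    open ≤-Reasoning
    m n : ℕ
    m = sz (list nat) s
    n = length M
    arith : ∀ a n → 1 + (2 + (a + 2 * n) + (a + n * (1 + a + 2 * n))) ≡
                    a + ((1 + a + 2 * suc n) + n * (1 + a + 2 * n))
    arith = solve-∀
  mono : ∀ s (M : List (List Bool)) → let N = sz (unit ⊗ list nat ⊗ list (list bool)) (tt , s , M) in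
    sz (list nat) s + length M * (1 + sz (list nat) s + 2 * length M) ≤ N + N * (1 + N + 2 * N)
  mono s M = +-mono-≤ s≤ (*-mono-≤ n≤ (+-mono-≤ (+-monoʳ-≤ 1 s≤) (*-monoʳ-≤ 2 n≤)))
    where
    N : ℕ
    N = sz (unit ⊗ list nat ⊗ list (list bool)) (tt , s , M)
    s≤ : sz (list nat) s ≤ N
    s≤ = m≤n⇒m≤1+n (m≤n⇒m≤1+n (m≤n⇒m≤1+n (m≤m+n _ _)))
    n≤ : length M ≤ N
    n≤ = ≤-trans (length≤sz (list bool) M) (m≤n⇒m≤1+n (m≤n⇒m≤1+n (m≤n⇒m≤1+n (m≤n+m _ (sz (list nat) s)))))

-- The single steps of the algorithm in polynomial time

LIT REL : Ty
LIT = nat ⊗ col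
REL = list (LIT ⊗ LIT)

eqColP : PTime (col ⊗ col) bool λ (c , d) → toℕ c ≡ᵇ toℕ d
eqColP = eqℕP ∘P ⟨ toℕP ∘P fstP , toℕP ∘P sndP ⟩P

eqLitP : PTime (LIT ⊗ LIT) bool λ (p , q) → eqLit p q
eqLitP = andP (eqℕP ∘P ⟨ fstP ∘P fstP , fstP ∘P sndP ⟩P) (eqColP ∘P ⟨ sndP ∘P fstP , sndP ∘P sndP ⟩P)

memP : PTime ((LIT ⊗ LIT) ⊗ REL) bool λ (pq , P) → mem pq P
memP = anyP (andP (eqLitP ∘P ⟨ fstP ∘P fstP , fstP ∘P sndP ⟩P) (eqLitP ∘P ⟨ sndP ∘P fstP , sndP ∘P sndP ⟩P))

adjacentP : PTime (list (list bool) ⊗ nat ⊗ nat) bool λ (M , u , v) → adjacent M u v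
adjacentP = nthP false refl ∘P ⟨ nthP [] refl ∘P ⟨ fstP , fstP ∘P sndP ⟩P , sndP ∘P sndP ⟩P

compatP : PTime (list (list bool) ⊗ LIT ⊗ LIT) bool λ (M , pq) → compat M pq
compatP = andP
  (ifP (eqℕP ∘P ⟨ fstP ∘P p , fstP ∘P q ⟩P) (eqColP ∘P ⟨ sndP ∘P p , sndP ∘P q ⟩P) (constP true))
  (ifP (adjacentP ∘P ⟨ fstP , ⟨ fstP ∘P p , fstP ∘P q ⟩P ⟩P)
       (notP (eqℕP ∘P ⟨ toℕP ∘P sndP ∘P p , monusP ∘P ⟨ constP 2 , toℕP ∘P sndP ∘P q ⟩P ⟩P))
       (constP true))
  where
  p : PTime (list (list bool) ⊗ LIT ⊗ LIT) LIT λ (M , p , q) → p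
  p = fstP ∘P sndP
  q : PTime (list (list bool) ⊗ LIT ⊗ LIT) LIT λ (M , p , q) → q
  q = sndP ∘P sndP

allowedP : PTime (list (list bool) ⊗ list nat) REL λ (M , vs) → allowed M vs
allowedP = filterP compatP ∘P ⟨ fstP , productP ∘P ⟨ literalsP , literalsP ⟩P ⟩P
  where
  literalsP : PTime (list (list bool) ⊗ list nat) (list LIT) λ (M , vs) → literals vs
  literalsP = productP ∘P ⟨ sndP , constP colours ⟩P

elimP : PTime (nat ⊗ list col ⊗ REL) REL λ (w , E , P) → elim w E P
elimP = filterP (anyP
    (andP (memP ∘P ⟨ ⟨ fstP ∘P pq , we ⟩P , P ⟩P)
    (andP (memP ∘P ⟨ ⟨ we , we ⟩P , P ⟩P)
          (memP ∘P ⟨ ⟨ we , sndP ∘P pq ⟩P , P ⟩P)))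
    ∘P ⟨ idP , fstP ∘P sndP ∘P fstP ⟩P)
  ∘P ⟨ idP , sndP ∘P sndP ⟩P
  where
  Γ : Ty
  Γ = ((nat ⊗ list col ⊗ REL) ⊗ LIT ⊗ LIT) ⊗ col
  P : PTime Γ REL λ (((w , E , P) , pq) , e) → P
  P = sndP ∘P sndP ∘P fstP ∘P fstP
  pq : PTime Γ (LIT ⊗ LIT) λ (((w , E , P) , pq) , e) → pq
  pq = sndP ∘P fstP
  we : PTime Γ LIT λ (((w , E , P) , pq) , e) → w , e
  we = ⟨ fstP ∘P fstP ∘P fstP , sndP ⟩P

sz-elimAll : ∀ vs P → sz REL (elimAll vs P) ≤ sz REL P
sz-elimAll []       P = ≤-refl
sz-elimAll (w ∷ vs) P = ≤-trans (sz-filterᵇ (LIT ⊗ LIT) _ (elimAll vs P)) (sz-elimAll vs P)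

elimAllP : PTime (list nat ⊗ REL) REL λ (vs , P) → elimAll vs P
elimAllP = foldrP {G = unit} (elimP ∘P ⟨ fstP ∘P sndP , ⟨ constP colours , sndP ∘P sndP ⟩P ⟩P) ι
    (λ _ P vs → ≤-trans (sz-elimAll vs P) (m≤n⇒m≤1+n (m≤n⇒m≤1+n (m≤n⇒m≤1+n (m≤m+n _ _)))))
  ∘P ⟨ constP tt , ⟨ sndP , fstP ⟩P ⟩P

acceptP : PTime REL bool accept
acceptP = anyP
    (andP (eqℕP ∘P ⟨ toℕP ∘P sndP ∘P p , constP 0 ⟩P)
    (andP (eqℕP ∘P ⟨ toℕP ∘P sndP ∘P q , constP 2 ⟩P)
    (andP (memP ∘P ⟨ ⟨ p , p ⟩P , fstP ⟩P)
          (memP ∘P ⟨ ⟨ q , q ⟩P , fstP ⟩P))))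
  ∘P ⟨ idP , idP ⟩P
  where
  p : PTime (REL ⊗ LIT ⊗ LIT) LIT λ (P , p , q) → p
  p = fstP ∘P sndP
  q : PTime (REL ⊗ LIT ⊗ LIT) LIT λ (P , p , q) → q
  q = sndP ∘P sndP

-- Opaque, so that the program and its time bound stay symbolic in the estimates that follow.
opaque
  splitP : PTime (nat ⊗ REL) (list REL) λ (x , P) → split x P
  splitP = mapP (elimP ∘P ⟨ fstP ∘P fstP , ⟨ consP ∘P ⟨ sndP , constP [] ⟩P , sndP ∘P fstP ⟩P ⟩P)
    ∘P ⟨ idP , constP colours ⟩P

chosenP : PTime (list (list bool) ⊗ list bool) (list nat) λ (M , X) → chosen M X
chosenP = filterP (nthP false refl) ∘P ⟨ sndP , verticesP ∘P fstP ⟩P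

-- Enumeration of the colourings of X

length-concatMap-split : ∀ x Ps → length (concatMap (split x) Ps) ≡ 3 * length Ps
length-concatMap-split x []       = refl
length-concatMap-split x (P ∷ Ps) =
  trans (cong (3 +_) (length-concatMap-split x Ps)) (sym (*-suc 3 (length Ps)))

length-branches : ∀ xs P → length (branches xs (P ∷ [])) ≡ 3 ^ length xs
length-branches []       P = refl
length-branches (x ∷ xs) P =
  trans (length-concatMap-split x (branches xs (P ∷ []))) (cong (3 *_) (length-branches xs P))

sz-branches : ∀ xs {m Ps} → All (λ P → sz REL P ≤ m) Ps → All (λ P → sz REL P ≤ m) (branches xs Ps)
sz-branches []       le = le
sz-branches (x ∷ xs) le = sz-splits (sz-branches xs le)
  where
  sz-splits : ∀ {m Ps} → All (λ P → sz REL P ≤ m) Ps →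
              All (λ P → sz REL P ≤ m) (concatMap (split x) Ps)
  sz-splits []                 = []
  sz-splits (_∷_ {P} le les) =
    ++⁺ (smaller colA ∷ smaller colS ∷ smaller colB ∷ []) (sz-splits les)
    where
    smaller : ∀ c → sz REL (elim x (c ∷ []) P) ≤ _
    smaller c = ≤-trans (sz-filterᵇ (LIT ⊗ LIT) _ P) le

-- Running time of the enumeration and of the whole program

branchesCmd : Cmd
branchesCmd = foldrCmd (0 ≔ `tl (var 0) ⨟ concatMapCmd (code splitP))

-- The layout expected by `foldrCmd`: environment, accumulator, list. The environment holds the
-- vertices, which the final check needs again.
STATE : Ty
STATE = list nat ⊗ list REL ⊗ list nat

-- The output has `3 ^ length xs` entries, so this is no instance of `PTime`. Each step meets at
-- most that many relations, none larger than `P`, so that splitting one costs a polynomial in `N`.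
-- A split yields three relations, which explains `3 * 60`.
runs-branches : ∀ vs P xs → let N = sz STATE (vs , P ∷ [] , xs) in
  Runs branchesCmd (enc STATE (vs , P ∷ [] , xs)) (enc (list REL) (branches xs (P ∷ [])))
       (30 + length xs * (50 + (3 + (50 + 3 ^ length xs * (200 + ⟪ time splitP ⟫ N + 3 * 60)))))
runs-branches vs P xs = runs-foldr {S = list REL} vs (λ x → concatMap (split x)) (P ∷ [])
  (stepTime (length xs)) xs (steps xs (≤-refl) (s≤s (≤-trans arg≤ (≤-trans (n≤1+n _) (m≤n+m _ (sz (list nat) vs))))))
  where
  N : ℕ
  N = sz STATE (vs , P ∷ [] , xs)
  stepTime : ℕ → ℕ
  stepTime k = 3 + (50 + 3 ^ k * (200 + ⟪ time splitP ⟫ N + 3 * 60))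
  arg≤ : sz (list nat) xs + sz REL P ≤ sz (list REL) (P ∷ []) + sz (list nat) xs
  arg≤ = ≤-trans (≤-reflexive (+-comm (sz (list nat) xs) (sz REL P)))
                 (+-monoˡ-≤ (sz (list nat) xs) (m≤n⇒m≤1+n (m≤m+n (sz REL P) 1)))
  steps : ∀ {k} zs → length zs ≤ k → 1 + (sz (list nat) zs + sz REL P) ≤ N →
    StepsRun {G = list nat} {S = list REL} {C = 0 ≔ `tl (var 0) ⨟ concatMapCmd (code splitP)}
      vs (λ x → concatMap (split x)) (P ∷ []) (stepTime k) zs
  steps []       _   _  = tt
  steps {k} (x ∷ zs) ≤k ≤N =
    runs-≤ (+-monoʳ-≤ 3 (+-monoʳ-≤ 50 (*-monoˡ-≤ (200 + ⟪ time splitP ⟫ N + 3 * 60)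
        (≤-trans (≤-reflexive (length-branches zs P)) (^-monoʳ-≤ 3 (≤-trans (n≤1+n _) ≤k))))))
      (runs-seq (runs-assign _ λ σ → cong tail)
        (runs-concatMap {G = nat} {A = REL} {B = REL} {g = x} (split x)
          (All.map (λ {Q} le → runs-≤ (poly-mono (time splitP) (small {Q} le)) (runs splitP (x , Q)) , ≤-refl)
            (sz-branches zs (≤-refl {sz REL P} ∷ []))))) ,
    steps zs (≤-trans (n≤1+n _) ≤k)
      (≤-trans (s≤s (+-monoˡ-≤ (sz REL P) (m≤n⇒m≤1+n (m≤n+m _ (sz nat x))))) ≤N)
    where
    small : ∀ {Q} → sz REL Q ≤ sz REL P → sz (nat ⊗ REL) (x , Q) ≤ N
    small le = ≤-trans (s≤s (+-mono-≤ (m≤n⇒m≤1+n (m≤m+n (sz nat x) (sz (list nat) zs))) le)) ≤N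

INPUT : Ty
INPUT = list (list bool) ⊗ list bool

prepare : List (List Bool) × List Bool → List ℕ × List Rel × List ℕ
prepare (M , X) = vertices M , allowed M (vertices M) ∷ [] , chosen M X

opaque
  prepareP : PTime INPUT STATE prepare
  prepareP = ⟨ verticesP ∘P fstP ,
    ⟨ consP ∘P ⟨ allowedP ∘P ⟨ fstP , verticesP ∘P fstP ⟩P , constP [] ⟩P , chosenP ⟩P ⟩P

opaque
  checkP : PTime (list nat ⊗ REL) bool λ (vs , P) → accept (elimAll vs P)
  checkP = acceptP ∘P elimAllP

opaque
  decideCmd : Cmd
  decideCmd = code prepareP ⨟ pairCmd (0 ≔ `hd (var 0)) branchesCmd ⨟ anyCmd (code checkP)

  -- What remains of the running time once the factor `3 ^ k` is taken out. The constants come from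
  -- the programs involved: 61 = 28 + 3 + 30, 103 = 50 + 3 + 50 and 380 = 200 + 3 * 60.
  decideTime : Poly
  decideTime = time prepareP ⊕
    (con 61 ⊕ grow prepareP ⊛ (con 103 ⊕ (con 380 ⊕ time splitP ⊚ grow prepareP)) ⊕
    (con 50 ⊕ (con 100 ⊕ time checkP ⊚ grow prepareP)))

  runs-decide : ∀ M X → Runs decideCmd (enc INPUT (M , X)) (encodeBool (decide M X))
                             (3 ^ length (chosen M X) * ⟪ decideTime ⟫ (sz INPUT (M , X)))
  runs-decide M X = runs-≤ bound
    (runs-seq (runs prepareP (M , X))
      (runs-seq (runs-pair (runs-assign (`hd (var 0)) λ σ → cong head)
                           (runs-branches vs P xs))
        (runs-any {G = list nat} {A = REL} {C = code checkP} {g = vs} (λ Q → accept (elimAll vs Q))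
          (All.map (λ {Q} le → runs-≤ (poly-mono (time checkP) (small {Q} le)) (runs checkP (vs , Q)))
            (sz-branches xs (≤-refl {sz REL P} ∷ []))))))
    where
    vs xs : List ℕ
    vs = vertices M
    xs = chosen M X
    P : Rel
    P = allowed M vs
    N K 3ᵏ : ℕ
    N = sz STATE (vs , P ∷ [] , xs)
    K = ⟪ grow prepareP ⟫ (sz INPUT (M , X))
    3ᵏ = 3 ^ length xs
    N≤K : N ≤ K
    N≤K = grows prepareP (M , X)
    small : ∀ {Q} → sz REL Q ≤ sz REL P → sz (list nat ⊗ REL) (vs , Q) ≤ K
    small le = ≤-trans (s≤s (+-monoʳ-≤ (sz (list nat) vs)
      (≤-trans le (m≤n⇒m≤1+n (≤-trans (m≤n⇒m≤1+n (m≤m+n (sz REL P) 1)) (m≤m+n _ (sz (list nat) xs))))))) N≤K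
    xs≤K : length xs ≤ K
    xs≤K = ≤-trans (length≤sz nat xs)
      (≤-trans (m≤n⇒m≤1+n (≤-trans (m≤n⇒m≤1+n (m≤n+m _ (sz (list REL) (P ∷ [])))) (m≤n+m _ (sz (list nat) vs)))) N≤K)
    ≤3ᵏ* : ∀ m → m ≤ 3ᵏ * m
    ≤3ᵏ* m = m≤n*m m 3ᵏ {{m^n≢0 3 (length xs)}}
    F t₀ t₁ t₂ : ℕ
    F = 28 + (3 + (30 + length xs * (50 + (3 + (50 + 3ᵏ * (200 + ⟪ time splitP ⟫ N + 3 * 60))))))
    t₀ = ⟪ time prepareP ⟫ (sz INPUT (M , X))
    t₁ = ⟪ time splitP ⟫ K
    t₂ = ⟪ time checkP ⟫ K
    open ≤-Reasoning
    arith₁ : ∀ t₀ L E s t₂ →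
      t₀ + ((28 + (3 + (30 + L * (50 + (3 + (50 + E * (200 + s + 3 * 60))))))) + (50 + E * (100 + t₂))) ≡
      t₀ + (61 + L * (103 + E * (380 + s)) + (50 + E * (100 + t₂)))
    arith₁ = solve-∀
    arith₂ : ∀ t₀ G E s t₂ →
      E * t₀ + (E * 61 + G * (E * 103 + E * s) + (E * 50 + E * t₂)) ≡
      E * (t₀ + (61 + G * (103 + s) + (50 + t₂)))
    arith₂ = solve-∀
    bound : t₀ + (F + (50 + length (branches xs (P ∷ [])) * (100 + t₂))) ≤
            3ᵏ * ⟪ decideTime ⟫ (sz INPUT (M , X))
    bound = begin
      t₀ + (F + (50 + length (branches xs (P ∷ [])) * (100 + t₂)))
        ≡⟨ cong (λ n → t₀ + (F + (50 + n))) (cong (_* (100 + t₂)) (length-branches xs P)) ⟩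
      t₀ + (F + (50 + 3ᵏ * (100 + t₂)))
        ≡⟨ arith₁ t₀ (length xs) 3ᵏ (⟪ time splitP ⟫ N) t₂ ⟩
      t₀ + (61 + length xs * (103 + 3ᵏ * (380 + ⟪ time splitP ⟫ N)) + (50 + 3ᵏ * (100 + t₂)))
        -- Summands that lack the factor `3ᵏ` are multiplied by it, so that it can be pulled out of
        -- the whole sum.
        ≤⟨ +-mono-≤ (≤3ᵏ* t₀) (+-mono-≤
             (+-mono-≤ (≤3ᵏ* 61) (*-mono-≤ xs≤K (+-mono-≤ (≤3ᵏ* 103)
               (*-monoʳ-≤ 3ᵏ (+-monoʳ-≤ 380 (poly-mono (time splitP) N≤K))))))
             (+-monoˡ-≤ (3ᵏ * (100 + t₂)) (≤3ᵏ* 50))) ⟩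
      3ᵏ * t₀ + (3ᵏ * 61 + K * (3ᵏ * 103 + 3ᵏ * (380 + t₁)) + (3ᵏ * 50 + 3ᵏ * (100 + t₂)))
        ≡⟨ arith₂ t₀ K 3ᵏ (380 + t₁) (100 + t₂) ⟩
      3ᵏ * (t₀ + (61 + K * (103 + (380 + t₁)) + (50 + (100 + t₂)))) ∎

-- Correctness of elimination and branching

eqLit⇒≡ : ∀ p q → T (eqLit p q) → p ≡ q
eqLit⇒≡ (u , c) (v , d) t with to T-∧ t
... | u≡v , c≡d = cong₂ _,_ (≡ᵇ⇒≡ u v u≡v) (toℕ-injective (≡ᵇ⇒≡ _ _ c≡d))

eqLit-refl : ∀ p → T (eqLit p p)
eqLit-refl (u , c) = from T-∧ (≡⇒≡ᵇ u u refl , ≡⇒≡ᵇ (toℕ c) _ refl)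

mem⇒∈ : ∀ pq P → T (mem pq P) → pq ∈ P
mem⇒∈ (p , q) P t with find (any⁻ _ P t)
... | (p′ , q′) , pq∈P , eq with to T-∧ eq
... | p≡p′ , q≡q′ with eqLit⇒≡ p p′ p≡p′ | eqLit⇒≡ q q′ q≡q′
... | refl | refl = pq∈P

∈⇒mem : ∀ {pq P} → pq ∈ P → T (mem pq P)
∈⇒mem {p , q} pq∈P =
  any⁺ _ (lose pq∈P (from T-∧ (eqLit-refl p , eqLit-refl q)))

elim-⊆ : ∀ {w E P pq} → pq ∈ elim w E P → pq ∈ P
elim-⊆ {P = P} pq∈ = proj₁ (∈-filter⁻ (T? ∘ _) {xs = P} pq∈)

elim⁻ : ∀ {w E P p q} → (p , q) ∈ elim w E P →
  ∃[ e ] (e ∈ E × (p , w , e) ∈ P × ((w , e) , w , e) ∈ P × ((w , e) , q) ∈ P)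
elim⁻ {w} {E} {P} pq∈ with find (any⁻ _ E (proj₂ (∈-filter⁻ (T? ∘ _) {xs = P} pq∈)))
... | e , e∈E , t with to T-∧ t
... | t₁ , t′ with to T-∧ t′
... | t₂ , t₃ = e , e∈E , mem⇒∈ _ P t₁ , mem⇒∈ _ P t₂ , mem⇒∈ _ P t₃

elim⁺ : ∀ {w E P p q e} → (p , q) ∈ P → e ∈ E →
  (p , w , e) ∈ P → ((w , e) , w , e) ∈ P → ((w , e) , q) ∈ P → (p , q) ∈ elim w E P
elim⁺ pq∈P e∈E ∈₁ ∈₂ ∈₃ = ∈-filter⁺ (T? ∘ _) pq∈P
  (any⁺ _ (lose e∈E (from T-∧ (∈⇒mem ∈₁ , from T-∧ (∈⇒mem ∈₂ , ∈⇒mem ∈₃)))))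

Symmetric : Rel → Set
Symmetric P = ∀ {p q} → (p , q) ∈ P → (q , p) ∈ P

elim-symmetric : ∀ {w E P} → Symmetric P → Symmetric (elim w E P)
elim-symmetric {w} {E} {P} P-sym pq∈ =
  let e , e∈E , ∈₁ , ∈₂ , ∈₃ = elim⁻ {w} {E} {P} pq∈
  in elim⁺ (P-sym (elim-⊆ {w} {E} pq∈)) e∈E (P-sym ∈₃) ∈₂ (P-sym ∈₁)

-- A partial solution. The case of equal literals is included, so membership in `ls` entails the
-- loop in `P`.
Clique : List Lit → Rel → Set
Clique ls P = ∀ {p q} → p ∈ ls → q ∈ ls → (p , q) ∈ P

clique-elim⁺ : ∀ {ls w E P e} → (w , e) ∈ ls → e ∈ E → Clique ls P → Clique ls (elim w E P)
clique-elim⁺ we∈ e∈E K p∈ q∈ = elim⁺ (K p∈ q∈) e∈E (K p∈ we∈) (K we∈ we∈) (K we∈ q∈)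

AtMostTwo : (Colour → Set) → Set
AtMostTwo D = ∃[ e₁ ] ∃[ e₂ ] (∀ {e} → D e → e ≡ e₁ ⊎ e ≡ e₂)

-- If both colours of w were blocked, by p₁ and p₂ say, then elim would have removed (p₁ , p₂).
clique-elim⁻ : ∀ {ls w E P p₀} → Symmetric P →
  AtMostTwo (λ e → e ∈ E × ((w , e) , w , e) ∈ P) → p₀ ∈ ls →
  Clique ls (elim w E P) → ∃[ e ] Clique ((w , e) ∷ ls) P
clique-elim⁻ {ls} {w} {E} {P} P-sym (e₁ , e₂ , two) p₀∈ K =
  choose (All.all? (λ p → T? _) ls) (All.all? (λ p → T? _) ls)
  where
  Fits : Colour → Lit → Set
  Fits e p = T (mem (p , w , e) P ∧ mem ((w , e) , w , e) P)

  fits : ∀ {e p} → (p , w , e) ∈ P → ((w , e) , w , e) ∈ P → Fits e p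
  fits ∈₁ ∈₂ = from T-∧ (∈⇒mem ∈₁ , ∈⇒mem ∈₂)

  extend : ∀ {e} → All (Fits e) ls → Clique ((w , e) ∷ ls) P
  -- The loop at the new literal is read off from `Fits` at `p₀`; for empty `ls` the hypothesis `a`
  -- would say nothing.
  extend a (here refl) (here refl) = mem⇒∈ _ P (proj₂ (to T-∧ (All.lookup a p₀∈)))
  extend a (here refl) (there q∈)  = P-sym (mem⇒∈ _ P (proj₁ (to T-∧ (All.lookup a q∈))))
  extend a (there p∈)  (here refl) = mem⇒∈ _ P (proj₁ (to T-∧ (All.lookup a p∈)))
  extend a (there p∈)  (there q∈)  = elim-⊆ {w} {E} (K p∈ q∈)

  blocked : ∀ {e} → ¬ All (Fits e) ls → ∃[ p ] (p ∈ ls × ¬ Fits e p)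
  blocked ¬a = find (¬All⇒Any¬ (λ p → T? _) ls ¬a)

  bothBlocked : ¬ All (Fits e₁) ls → ¬ All (Fits e₂) ls → ⊥
  bothBlocked ¬a₁ ¬a₂ =
    let p₁ , p₁∈ , ¬fits₁ = blocked {e₁} ¬a₁
        p₂ , p₂∈ , ¬fits₂ = blocked {e₂} ¬a₂
        e , e∈E , ∈₁ , ∈₂ , ∈₃ = elim⁻ {w} {E} (K p₁∈ p₂∈)
    in [ (λ e≡ → ¬fits₁ (subst (λ e → Fits e p₁) e≡ (fits {e} ∈₁ ∈₂)))
       , (λ e≡ → ¬fits₂ (subst (λ e → Fits e p₂) e≡ (fits {e} (P-sym ∈₃) ∈₂))) ]′
         (two (e∈E , ∈₂))

  choose : Dec (All (Fits e₁) ls) → Dec (All (Fits e₂) ls) → ∃[ e ] Clique ((w , e) ∷ ls) P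
  choose (yes a₁) _        = e₁ , extend a₁
  choose (no _)   (yes a₂) = e₂ , extend a₂
  choose (no ¬a₁) (no ¬a₂) = ⊥-elim (bothBlocked ¬a₁ ¬a₂)

Covers : List Lit → List ℕ → Set
Covers ls vs = ∀ {v} → v ∈ vs → ∃[ c ] ((v , c) ∈ ls)

_⊑_ : List Lit → List Lit → Set
ls ⊑ ls′ = ∀ {p} → p ∈ ls → p ∈ ls′

∈-colours : ∀ c → c ∈ colours
∈-colours colA = here refl
∈-colours colS = there (here refl)
∈-colours colB = there (there (here refl))

clique-elimAll⁺ : ∀ {ls P} vs → Covers ls vs → Clique ls P → Clique ls (elimAll vs P)
clique-elimAll⁺ []       cov K = K
clique-elimAll⁺ (w ∷ vs) cov K =
  let c , wc∈ = cov (here refl)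
  in clique-elim⁺ wc∈ (∈-colours c) (clique-elimAll⁺ vs (cov ∘ there) K)

elimAll-⊆ : ∀ vs {P pq} → pq ∈ elimAll vs P → pq ∈ P
elimAll-⊆ []       pq∈ = pq∈
elimAll-⊆ (w ∷ vs) pq∈ = elimAll-⊆ vs (elim-⊆ {w} {colours} {elimAll vs _} pq∈)

elimAll-symmetric : ∀ vs {P} → Symmetric P → Symmetric (elimAll vs P)
elimAll-symmetric []       P-sym = P-sym
elimAll-symmetric (w ∷ vs) P-sym = elim-symmetric {w} {colours} (elimAll-symmetric vs P-sym)

-- The head of the list is eliminated last, so its elimination is undone first, and the enlarged
-- clique is passed on. Two colours per vertex in `P` are enough, because every intermediate
-- relation is contained in `P`.
clique-elimAll⁻ : ∀ {P} → Symmetric P → ∀ vs →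
  (∀ {w} → w ∈ vs → AtMostTwo (λ e → ((w , e) , w , e) ∈ P)) →
  ∀ {ls p₀} → p₀ ∈ ls → Clique ls (elimAll vs P) →
  ∃[ ls′ ] (ls ⊑ ls′ × Covers ls′ vs × Clique ls′ P)
clique-elimAll⁻ P-sym []       two {ls} p₀∈ K = ls , id , (λ ()) , K
clique-elimAll⁻ P-sym (w ∷ vs) two {ls} p₀∈ K =
  let e₁ , e₂ , two′ = two (here refl)
      e , K′ = clique-elim⁻ {w = w} {E = colours} (elimAll-symmetric vs P-sym)
                 (e₁ , e₂ , λ (_ , ∈P) → two′ (elimAll-⊆ vs ∈P)) p₀∈ K
      ls′ , sub , cov , K″ = clique-elimAll⁻ P-sym vs (two ∘ there) (there p₀∈) K′
  in ls′ , sub ∘ there , (λ { (here refl) → e , sub (here refl) ; (there v∈) → cov v∈ }) , K″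

split⁻ : ∀ {x P Q} → Q ∈ split x P → ∃[ c ] (Q ≡ elim x (c ∷ []) P)
split⁻ Q∈ with ∈-map⁻ _ {xs = colours} Q∈
... | c , _ , eq = c , eq

-- The branch to follow is the one that guesses for each `x` a colour which `ls` gives to it.
clique-branches⁺ : ∀ {ls P} xs → Covers ls xs → Clique ls P →
  ∃[ Q ] (Q ∈ branches xs (P ∷ []) × Clique ls Q)
clique-branches⁺ {P = P} []       cov K = P , here refl , K
clique-branches⁺         (x ∷ xs) cov K
  with R , R∈ , K′ ← clique-branches⁺ xs (cov ∘ there) K
  with c , xc∈ ← cov (here refl)
  = elim x (c ∷ []) R ,
    ∈-concatMap⁺ (split x) (lose R∈ (∈-map⁺ (λ c → elim x (c ∷ []) R) (∈-colours c))) ,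
    clique-elim⁺ {E = c ∷ []} xc∈ (here refl) K′

-- What a leaf of the enumeration retains. By `coloured`, every literal that is the first entry of a
-- pair of `Q` is compatible with the guessed literal of each `x`; this is stated in terms of `P`,
-- so that it can be read as a condition on edges.
record Branch (P : Rel) (xs : List ℕ) (Q : Rel) : Set where
  field
    subset    : ∀ {pq} → pq ∈ Q → pq ∈ P
    symmetric : Symmetric Q
    coloured  : ∀ {x} → x ∈ xs → ∃[ c ] (∀ {p q} → (p , q) ∈ Q → (p , x , c) ∈ P)
    clique⁻   : ∀ {ls p₀} → p₀ ∈ ls → Clique ls Q → ∃[ ls′ ] (ls ⊑ ls′ × Clique ls′ P)

open Branch

branches⁻ : ∀ {P} → Symmetric P → ∀ xs {Q} → Q ∈ branches xs (P ∷ []) → Branch P xs Q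
branches⁻ P-sym []       (here refl) = record
  { subset    = id
  ; symmetric = P-sym
  ; coloured  = λ ()
  ; clique⁻   = λ {ls} _ K → ls , id , K
  }
branches⁻ {P} P-sym (x ∷ xs) Q∈
  with R , R∈ , Q∈R ← find (∈-concatMap⁻ (split x) {xs = branches xs (P ∷ [])} Q∈)
  with c , refl ← split⁻ {x} {R} Q∈R
  = record
  { subset    = subset IH ∘ elim-⊆ {x} {c ∷ []} {R}
  ; symmetric = elim-symmetric {x} {c ∷ []} {R} (symmetric IH)
  ; coloured  = coloured′
  ; clique⁻   = clique′
  }
  where
  IH : Branch P xs R
  IH = branches⁻ P-sym xs R∈
  coloured′ : ∀ {y} → y ∈ x ∷ xs → ∃[ d ] (∀ {p q} → (p , q) ∈ elim x (c ∷ []) R → (p , y , d) ∈ P)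
  coloured′ (here refl) = c , λ pq∈ → case elim⁻ {x} {c ∷ []} {R} pq∈ of λ
    { (_ , here refl , ∈R , _) → subset IH ∈R }
  coloured′ (there y∈)  = let d , h = coloured IH y∈ in d , h ∘ elim-⊆ {x} {c ∷ []} {R}
  clique′ : ∀ {ls p₀} → p₀ ∈ ls → Clique ls (elim x (c ∷ []) R) → ∃[ ls′ ] (ls ⊑ ls′ × Clique ls′ P)
  clique′ p₀∈ K =
    -- Undoing a guess is undoing an elimination with a single available colour, so both candidates
    -- are `c`.
    let e , K′ = clique-elim⁻ {w = x} {E = c ∷ []} (symmetric IH)
                   (c , c , λ { (here refl , _) → inj₁ refl }) p₀∈ K
        ls′ , sub , K″ = clique⁻ IH (there p₀∈) K′
    in ls′ , sub ∘ there , K″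

accept⁻ : ∀ P → T (accept P) → ∃[ a ] ∃[ b ]
  (((a , colA) , b , colB) ∈ P × ((a , colA) , a , colA) ∈ P × ((b , colB) , b , colB) ∈ P)
accept⁻ P t with find (any⁻ _ P t)
... | ((a , c) , b , d) , ∈P , t′ with to (T-∧ {toℕ c ≡ᵇ 0}) t′
... | c≡ , t″ with to (T-∧ {toℕ d ≡ᵇ 2}) t″
... | d≡ , t‴ with to (T-∧ {mem ((a , c) , a , c) P}) t‴
... | m₁ , m₂ with toℕ-injective {i = c} {colA} (≡ᵇ⇒≡ _ _ c≡) | toℕ-injective {i = d} {colB} (≡ᵇ⇒≡ _ _ d≡)
... | refl | refl = a , b , ∈P , mem⇒∈ _ P m₁ , mem⇒∈ _ P m₂

accept⁺ : ∀ {ls P a b} → Clique ls P → (a , colA) ∈ ls → (b , colB) ∈ ls → T (accept P)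
accept⁺ {P = P} {a} {b} K a∈ b∈ = any⁺ _ (lose (K a∈ b∈)
  (from (T-∧ {mem ((a , colA) , a , colA) P}) (∈⇒mem (K a∈ a∈) , ∈⇒mem (K b∈ b∈))))

-- Colourings and independent cutsets of a graph

matrix : ∀ {n} → Graph n → List (List Bool)
matrix G = tabulate λ u → tabulate λ v → adj G u v

nth-tabulate : ∀ {A : Set} {n} d (f : Fin n → A) i → nth d (tabulate f) (toℕ i) ≡ f i
nth-tabulate d f zero    = refl
nth-tabulate d f (suc i) = nth-tabulate d (f ∘ suc) i

nth-toList : ∀ {A : Set} {n} d (xs : Vec A n) i → nth d (toList xs) (toℕ i) ≡ Vec.lookup xs i
nth-toList d (x ∷ xs) zero    = refl
nth-toList d (x ∷ xs) (suc i) = nth-toList d xs i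

adjacent-matrix : ∀ {n} (G : Graph n) u v → adjacent (matrix G) (toℕ u) (toℕ v) ≡ adj G u v
adjacent-matrix G u v =
  trans (cong (λ row → nth false row (toℕ v)) (nth-tabulate [] _ u)) (nth-tabulate false _ v)

-- A vector starts at index 0, whereas `downFrom` unfolds at the largest index; splitting off the 0
-- makes the count in `length-chosen` follow the vector.
downFrom-suc : ∀ n → downFrom (suc n) ≡ map suc (downFrom n) ++ 0 ∷ []
downFrom-suc zero    = refl
downFrom-suc (suc n) = cong (suc n ∷_) (downFrom-suc n)

filterᵇ-map : ∀ {A B : Set} (p : B → Bool) (f : A → B) xs →
  filterᵇ p (map f xs) ≡ map f (filterᵇ (p ∘ f) xs)
filterᵇ-map p f []       = refl
filterᵇ-map p f (x ∷ xs) with p (f x)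
... | true  = cong (f x ∷_) (filterᵇ-map p f xs)
... | false = filterᵇ-map p f xs

length-chosen : ∀ {n} (X : Subset n) →
  length (filterᵇ (nth false (toList X)) (downFrom n)) ≡ ∣ X ∣
length-chosen []                = refl
length-chosen {suc n} (b ∷ X) = trans
  (trans (cong (length ∘ filterᵇ p) (downFrom-suc n))
    (trans (cong length (filter-++ (T? ∘ p) (map suc (downFrom n)) (0 ∷ [])))
      (trans (length-++ (filterᵇ p (map suc (downFrom n))))
        (cong (_+ length (filterᵇ p (0 ∷ [])))
          (trans (cong length (filterᵇ-map p suc (downFrom n)))
            (trans (length-map suc (filterᵇ (p ∘ suc) (downFrom n))) (length-chosen X)))))))
  (last b)
  where
  p : ℕ → Bool
  p = nth false (toList (b ∷ X))
  last : ∀ b → ∣ X ∣ + length (filterᵇ (nth false (toList (b ∷ X))) (0 ∷ [])) ≡ ∣ b ∷ X ∣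
  last inside  = +-comm ∣ X ∣ 1
  last outside = +-comm ∣ X ∣ 0

vertices-matrix : ∀ {n} (G : Graph n) → vertices (matrix G) ≡ downFrom n
vertices-matrix {n} G = cong downFrom (length-tabulate {n = n} λ u → tabulate λ v → adj G u v)

∈-vertices⁺ : ∀ {n} (G : Graph n) i → toℕ i ∈ vertices (matrix G)
∈-vertices⁺ G i = subst (toℕ i ∈_) (sym (vertices-matrix G)) (∈-downFrom⁺ (toℕ<n i))

∈-vertices⁻ : ∀ {n} (G : Graph n) {v} → v ∈ vertices (matrix G) → ∃[ i ] (v ≡ toℕ i)
∈-vertices⁻ G {v} v∈ = fromℕ< v<n , sym (toℕ-fromℕ< v<n)
  where
  v<n : v < _
  v<n = ∈-downFrom⁻ (subst (v ∈_) (vertices-matrix G) v∈)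

∈-chosen⁺ : ∀ {n} (G : Graph n) {X i} → i ∈ˢ X → toℕ i ∈ chosen (matrix G) (toList X)
∈-chosen⁺ G {X} {i} i∈X = ∈-filter⁺ (T? ∘ nth false (toList X)) (∈-vertices⁺ G i)
  (subst T (sym (trans (nth-toList false X i) ([]=⇒lookup i∈X))) tt)

∈-chosen⁻ : ∀ {n} (G : Graph n) {X : Subset n} {v} → v ∈ chosen (matrix G) (toList X) → v ∈ vertices (matrix G)
∈-chosen⁻ G {X} v∈ = proj₁ (∈-filter⁻ (T? ∘ nth false (toList X)) {xs = vertices (matrix G)} v∈)

Compatible : Colour → Colour → Set
Compatible c d = T (not (toℕ c ≡ᵇ 2 ∸ toℕ d))

compatible-sym : ∀ c d → Compatible c d → Compatible d c
compatible-sym colA colA _ = tt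
compatible-sym colA colS _ = tt
compatible-sym colA colB ()
compatible-sym colS colA _ = tt
compatible-sym colS colS ()
compatible-sym colS colB _ = tt
compatible-sym colB colA ()
compatible-sym colB colS _ = tt
compatible-sym colB colB _ = tt

-- Every colour forbids exactly one colour at a neighbour: S forbids S, while A and B forbid each
-- other.
compatible-atMostTwo : ∀ d → AtMostTwo (λ c → Compatible c d)
compatible-atMostTwo colA = colA , colS ,
  λ { {colA} _ → inj₁ refl ; {colS} _ → inj₂ refl ; {colB} () }
compatible-atMostTwo colS = colA , colB ,
  λ { {colA} _ → inj₁ refl ; {colS} () ; {colB} _ → inj₂ refl }
compatible-atMostTwo colB = colS , colB ,
  λ { {colA} () ; {colS} _ → inj₁ refl ; {colB} _ → inj₂ refl }

T-if⁻ : ∀ b {x} → T (if b then x else true) → T b → T x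
T-if⁻ true t _ = t

T-if⁺ : ∀ b {x} → (T b → T x) → T (if b then x else true)
T-if⁺ true  h = h tt
T-if⁺ false h = tt

module _ {n : ℕ} (G : Graph n) where

  private
    M : List (List Bool)
    M = matrix G
    vs : List ℕ
    vs = vertices M

  allowedRel : Rel
  allowedRel = allowed M vs

  Allowed : Fin n → Colour → Fin n → Colour → Set
  Allowed i c j d = (i ≡ j → c ≡ d) × (Adj G i j → Compatible c d)

  allowed⁺ : ∀ {i c j d} → Allowed i c j d → ((toℕ i , c) , toℕ j , d) ∈ allowedRel
  allowed⁺ {i} {c} {j} {d} (eq , comp) = ∈-filter⁺ (T? ∘ compat M)
    (∈-cartesianProduct⁺ (∈-cartesianProduct⁺ (∈-vertices⁺ G i) (∈-colours c))
                         (∈-cartesianProduct⁺ (∈-vertices⁺ G j) (∈-colours d)))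
    (from T-∧
      ( T-if⁺ (toℕ i ≡ᵇ toℕ j) (λ i≡j → ≡⇒≡ᵇ _ _ (cong toℕ (eq (toℕ-injective (≡ᵇ⇒≡ _ _ i≡j)))))
      , T-if⁺ (adjacent M (toℕ i) (toℕ j)) (comp ∘ subst T (adjacent-matrix G i j))))

  ∈-literals⁻ : ∀ {p} → p ∈ literals vs → proj₁ p ∈ vs
  ∈-literals⁻ p∈ = proj₁ (∈-cartesianProduct⁻ vs colours p∈)

  allowed⁻ : ∀ {i c j d} → ((toℕ i , c) , toℕ j , d) ∈ allowedRel → Allowed i c j d
  allowed⁻ {i} {c} {j} {d} ∈P
    with to T-∧ (proj₂ (∈-filter⁻ (T? ∘ compat M) {xs = cartesianProduct (literals vs) (literals vs)} ∈P))
  ... | t₁ , t₂ =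
    (λ i≡j → toℕ-injective (≡ᵇ⇒≡ _ _ (T-if⁻ (toℕ i ≡ᵇ toℕ j) t₁ (≡⇒≡ᵇ _ _ (cong toℕ i≡j))))) ,
    λ ij → T-if⁻ (adjacent M (toℕ i) (toℕ j)) t₂ (subst T (sym (adjacent-matrix G i j)) ij)

  allowed-vertices : ∀ {u c v d} → ((u , c) , v , d) ∈ allowedRel → u ∈ vs × v ∈ vs
  allowed-vertices ∈P
    with ∈-cartesianProduct⁻ (literals vs) (literals vs)
           (proj₁ (∈-filter⁻ (T? ∘ compat M) {xs = cartesianProduct (literals vs) (literals vs)} ∈P))
  ... | p∈ , q∈ = ∈-literals⁻ p∈ , ∈-literals⁻ q∈

  allowed-symmetric : Symmetric allowedRel
  allowed-symmetric {u , c} {v , d} ∈P with allowed-vertices ∈P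
  ... | u∈ , v∈ with ∈-vertices⁻ G u∈ | ∈-vertices⁻ G v∈
  ... | i , refl | j , refl with allowed⁻ {i} {c} {j} {d} ∈P
  ... | eq , comp = allowed⁺ ((λ j≡i → sym (eq (sym j≡i))) , λ ji → compatible-sym c d (comp (adj-sym G ji)))

  -- A vertex outside X has a neighbour in X, whose colour rules out one of the three colours.
  branch-atMostTwo : ∀ {X} → Dominating G X → ∀ {Q} → Branch allowedRel (chosen M (toList X)) Q →
    ∀ {w} → w ∈ vs → AtMostTwo (λ e → ((w , e) , w , e) ∈ Q)
  branch-atMostTwo dom B w∈ with ∈-vertices⁻ G w∈
  ... | i , refl with dom i
  ... | inj₁ i∈X with coloured B (∈-chosen⁺ G i∈X)
  -- A vertex of `X` keeps only its guessed colour: its literal must be compatible with the guessed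
  -- literal of the same vertex.
  ...   | c , h = c , c , λ {e} ∈Q → inj₁ (proj₁ (allowed⁻ {i} {e} {i} {c} (h ∈Q)) refl)
  branch-atMostTwo dom B w∈ | i , refl | inj₂ (x , x∈X , ix) with coloured B (∈-chosen⁺ G x∈X)
  ...   | c , h with compatible-atMostTwo c
  ...   | e₁ , e₂ , two = e₁ , e₂ , λ {e} ∈Q → two (proj₂ (allowed⁻ {i} {e} {x} {c} (h ∈Q)) ix)

  Colouring : List Lit → Set
  Colouring ls = Clique ls allowedRel × Covers ls vs ×
    ∃[ a ] ∃[ b ] ((a , colA) ∈ ls × (b , colB) ∈ ls)

  decide⁺ : ∀ X {ls} → Colouring ls → T (decide M (toList X))
  decide⁺ X (K , cov , a , b , a∈ , b∈) =
    let Q , Q∈ , K′ = clique-branches⁺ (chosen M (toList X)) (cov ∘ ∈-chosen⁻ G {X}) K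
    in any⁺ _ (lose Q∈ (accept⁺ (clique-elimAll⁺ vs cov K′) a∈ b∈))

  pair-clique : ∀ {P p q} → Symmetric P → (p , q) ∈ P → (p , p) ∈ P → (q , q) ∈ P →
    Clique (p ∷ q ∷ []) P
  pair-clique P-sym pq∈ pp∈ qq∈ (here refl)         (here refl)         = pp∈
  pair-clique P-sym pq∈ pp∈ qq∈ (here refl)         (there (here refl)) = pq∈
  pair-clique P-sym pq∈ pp∈ qq∈ (there (here refl)) (here refl)         = P-sym pq∈
  pair-clique P-sym pq∈ pp∈ qq∈ (there (here refl)) (there (here refl)) = qq∈

  -- The two literals found by `accept` form the initial clique. Undoing the eliminations extends it
  -- to all vertices, and undoing the guesses turns it into a clique of the original relation.
  decide⁻ : ∀ {X} → Dominating G X → T (decide M (toList X)) → ∃[ ls ] Colouring ls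
  decide⁻ {X} dom t =
    let Q , Q∈ , t′ = find (any⁻ _ (branches (chosen M (toList X)) (allowedRel ∷ [])) t)
        a , b , ab∈ , aa∈ , bb∈ = accept⁻ (elimAll vs Q) t′
        B = branches⁻ allowed-symmetric (chosen M (toList X)) Q∈
        ls , sub , cov , K = clique-elimAll⁻ (symmetric B) vs (branch-atMostTwo dom B)
          {ls = (a , colA) ∷ (b , colB) ∷ []} (here refl)
          (pair-clique (elimAll-symmetric vs (symmetric B)) ab∈ aa∈ bb∈)
        ls′ , sub′ , K′ = clique⁻ B (sub (here refl)) K
    in ls′ , K′ , (λ v∈ → proj₁ (cov v∈) , sub′ (proj₂ (cov v∈))) ,
       a , b , sub′ (sub (here refl)) , sub′ (sub (there (here refl)))

  -- From a colouring to an independent cutset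

  module _ {ls} (K : Clique ls allowedRel) (cov : Covers ls vs) where

    colour : Fin n → Colour
    colour i = proj₁ (cov (∈-vertices⁺ G i))

    colour-allowed : ∀ i j → Allowed i (colour i) j (colour j)
    colour-allowed i j =
      allowed⁻ (K (proj₂ (cov (∈-vertices⁺ G i))) (proj₂ (cov (∈-vertices⁺ G j))))

    -- Undoing eliminations and guesses may add several literals of one vertex; the clause of
    -- `Allowed` for equal vertices forces them to agree.
    colour-unique : ∀ {i c} → (toℕ i , c) ∈ ls → colour i ≡ c
    colour-unique {i} {c} ∈ls =
      proj₁ (allowed⁻ {i} {colour i} {i} {c} (K (proj₂ (cov (∈-vertices⁺ G i))) ∈ls)) refl

    separator : Subset n
    separator = Vec.tabulate λ i → does (colour i Fin.≟ colS)

    ∈-separator⁻ : ∀ {i} → i ∈ˢ separator → colour i ≡ colS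
    ∈-separator⁻ {i} i∈ with colour i Fin.≟ colS in eq
    ... | yes c≡ = c≡
    ... | no _   with trans (sym ([]=⇒lookup i∈)) (trans (lookup∘tabulate _ i) (cong does eq))
    ...   | ()

    ∈-separator⁺ : ∀ {i} → colour i ≡ colS → i ∈ˢ separator
    ∈-separator⁺ {i} c≡ = lookup⇒[]= i separator
      (trans (lookup∘tabulate _ i) (dec-true (colour i Fin.≟ colS) c≡))

    separator-independent : Independent G separator
    separator-independent u v u∈ v∈ uv =
      subst₂ Compatible (∈-separator⁻ u∈) (∈-separator⁻ v∈) (proj₂ (colour-allowed u v) uv)

    -- A step of the path can enter neither S, which is removed, nor B, which is incompatible with
    -- A.
    A-closed : ∀ {u v} → colour u ≡ colA → Star (AdjIn G (∁ separator)) u v → colour v ≡ colA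
    A-closed u≡A ε = u≡A
    A-closed {u} u≡A (_◅_ {j = w} (_ , w∈ , uw) path) = A-closed (next (colour w) refl) path
      where
      next : ∀ c → colour w ≡ c → colour w ≡ colA
      next colA w≡ = w≡
      next colS w≡ = contradiction (∈-separator⁺ w≡) (x∈∁p⇒x∉p w∈)
      next colB w≡ = ⊥-elim (subst₂ Compatible u≡A w≡ (proj₂ (colour-allowed u w) uw))

    separator-cutset : ∀ {a b} → colour a ≡ colA → colour b ≡ colB → Cutset G separator
    separator-cutset {a} {b} a≡A b≡B connected
      with trans (sym b≡B) (A-closed a≡A (connected a b (outside-separator a≡A λ ()) (outside-separator b≡B λ ())))
      where
      outside-separator : ∀ {i c} → colour i ≡ c → ¬ c ≡ colS → i ∈ˢ ∁ separator
      outside-separator i≡c c≢S = x∉p⇒x∈∁p λ i∈ → c≢S (trans (sym i≡c) (∈-separator⁻ i∈))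
    ... | ()

  colouring⇒cutset : ∀ {ls} → Colouring ls → ∃[ S ] IndependentCutset G S
  colouring⇒cutset {ls} (K , cov , a , b , a∈ , b∈) =
    cutset a∈ b∈ (∈-vertices⁻ G (proj₁ (allowed-vertices (K a∈ a∈))))
                 (∈-vertices⁻ G (proj₁ (allowed-vertices (K b∈ b∈))))
    where
    cutset : ∀ {a b} → (a , colA) ∈ ls → (b , colB) ∈ ls →
      ∃[ i ] (a ≡ toℕ i) → ∃[ j ] (b ≡ toℕ j) → ∃[ S ] IndependentCutset G S
    cutset a∈ b∈ (i , refl) (j , refl) =
      separator K cov ,
      separator-cutset K cov (colour-unique K cov a∈) (colour-unique K cov b∈) ,
      separator-independent K cov

  sound : ∀ {X} → Dominating G X → T (decide M (toList X)) → ∃[ S ] IndependentCutset G S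
  sound dom t = colouring⇒cutset (proj₂ (decide⁻ dom t))

  -- From an independent cutset to a colouring

  module _ {S : Subset n} (ind : Independent G S) (reach? : ∀ u v → Dec (Star (AdjIn G (∁ S)) u v))
           (a : Fin n) where

    -- For `a` outside `S`, A is the component of `a` in G - S and B collects all other components;
    -- an edge between A and B would prolong a path from `a`.
    data Side (v : Fin n) : Colour → Set where
      inA : v ∉ˢ S → Star (AdjIn G (∁ S)) a v → Side v colA
      inS : v ∈ˢ S → Side v colS
      inB : v ∉ˢ S → ¬ Star (AdjIn G (∁ S)) a v → Side v colB

    side : ∀ v → ∃[ c ] Side v c
    side v with v ∈? S | reach? a v
    ... | yes v∈ | _       = colS , inS v∈
    ... | no v∉  | yes av  = colA , inA v∉ av
    ... | no v∉  | no ¬av  = colB , inB v∉ ¬av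

    side-compatible : ∀ {u v c d} → Side u c → Side v d → Adj G u v → Compatible c d
    side-compatible (inA _ _)     (inA _ _)     uv = tt
    side-compatible (inA _ _)     (inS _)       uv = tt
    side-compatible (inA u∉ au)   (inB v∉ ¬av)  uv =
      ¬av (au ◅◅ (x∉p⇒x∈∁p u∉ , x∉p⇒x∈∁p v∉ , uv) ◅ ε)
    side-compatible (inS _)       (inA _ _)     uv = tt
    side-compatible (inS u∈)      (inS v∈)      uv = ind _ _ u∈ v∈ uv
    side-compatible (inS _)       (inB _ _)     uv = tt
    side-compatible (inB u∉ ¬au)  (inA v∉ av)   uv =
      ¬au (av ◅◅ (x∉p⇒x∈∁p v∉ , x∉p⇒x∈∁p u∉ , adj-sym G uv) ◅ ε)
    side-compatible (inB _ _)     (inS _)       uv = tt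
    side-compatible (inB _ _)     (inB _ _)     uv = tt

    sides : List Lit
    sides = map (λ v → toℕ v , proj₁ (side v)) (allFin n)

    ∈-sides : ∀ v → (toℕ v , proj₁ (side v)) ∈ sides
    ∈-sides v = ∈-map⁺ (λ v → toℕ v , proj₁ (side v)) (∈-allFin v)

    sides-clique : Clique sides allowedRel
    sides-clique p∈ q∈
      with u , _ , refl ← ∈-map⁻ (λ v → toℕ v , proj₁ (side v)) p∈
      with v , _ , refl ← ∈-map⁻ (λ v → toℕ v , proj₁ (side v)) q∈
      = allowed⁺ ((λ { refl → refl }) , side-compatible (proj₂ (side u)) (proj₂ (side v)))

    sides-cover : Covers sides vs
    sides-cover v∈ with i , refl ← ∈-vertices⁻ G v∈ = _ , ∈-sides i

    side-A : a ∉ˢ S → proj₁ (side a) ≡ colA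
    side-A a∉ with a ∈? S | reach? a a
    ... | yes a∈ | _      = contradiction a∈ a∉
    ... | no _   | yes _  = refl
    ... | no _   | no ¬aa = contradiction ε ¬aa

    side-B : ∀ {b} → b ∉ˢ S → ¬ Star (AdjIn G (∁ S)) a b → proj₁ (side b) ≡ colB
    side-B {b} b∉ ¬ab with b ∈? S | reach? a b
    ... | yes b∈ | _      = contradiction b∈ b∉
    ... | no _   | yes ab = contradiction ab ¬ab
    ... | no _   | no _   = refl

    sides-colouring : ∀ {b} → a ∉ˢ S → b ∉ˢ S → ¬ Star (AdjIn G (∁ S)) a b → Colouring sides
    sides-colouring {b} a∉ b∉ ¬ab = sides-clique , sides-cover , toℕ a , toℕ b ,
      subst (λ c → (toℕ a , c) ∈ sides) (side-A a∉) (∈-sides a) ,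
      subst (λ c → (toℕ b , c) ∈ sides) (side-B b∉ ¬ab) (∈-sides b)

  -- The goal is stable, so reachability in G - S may be assumed decidable.
  complete : ∀ X → ∃[ S ] IndependentCutset G S → T (decide M (toList X))
  complete X (S , cut , ind) = decidable-stable (T? _) λ ¬t →
    -- `cut` refutes connectedness but yields no separated pair. Connectedness is therefore derived
    -- from `¬t`: a pair that is not joined would give a colouring, and `decide` would answer true.
    reachable? λ reach? → cut λ a b a∈ b∈ → case reach? a b of λ
      { (yes ab) → ab
      ; (no ¬ab) → ⊥-elim (¬t (decide⁺ X
          (sides-colouring ind reach? a (x∈∁p⇒x∉p a∈) (x∈∁p⇒x∉p b∈) ¬ab))) }
    where
    open RawMonad ¬¬-Monad using (rawApplicative)
    reachable? : ¬ ¬ (∀ u v → Dec (Star (AdjIn G (∁ S)) u v))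
    reachable? = Fin.sequence rawApplicative λ u → Fin.sequence rawApplicative λ v → ¬¬-excluded-middle

-- Agreement of the encodings and the final bound

enc-matrix : ∀ {n} (G : Graph n) → encodeGraph G ≡ enc (list (list bool)) (matrix G)
enc-matrix G = enc-tabulate (list bool) _ (λ u → tabulate (adj G u)) λ u →
  enc-tabulate bool _ (adj G u) λ v → refl
  where
  enc-tabulate : ∀ A {n} (e : Fin n → Tree) (f : Fin n → ⟦ A ⟧) → (∀ i → e i ≡ enc A (f i)) →
    encodeList (tabulate e) ≡ enc (list A) (tabulate f)
  enc-tabulate A {zero}  e f eq = refl
  enc-tabulate A {suc n} e f eq = cong₂ _∙_ (eq zero) (enc-tabulate A (e ∘ suc) (f ∘ suc) (eq ∘ suc))

enc-toList : ∀ {n} (X : Subset n) → encodeSubset X ≡ enc (list bool) (toList X)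
enc-toList []      = refl
enc-toList (b ∷ X) = cong (encodeBool b ∙_) (enc-toList X)

theorem4p6 : SolvableInTimeO* independentCutsetByDominatingSet (λ k → 3 ^ k)
theorem4p6 = decideCmd , factor , degree , solve
  where
  open ParameterizedProblem independentCutsetByDominatingSet
  open ≤-Reasoning
  factor degree : ℕ
  factor = proj₁ (poly-bounded decideTime)
  degree = proj₁ (proj₂ (poly-bounded decideTime))
  regroup : ∀ e c p → e * (c * p) ≡ c * e * p
  regroup = solve-∀
  solve : ∀ I → ∃[ answer ] ∃[ t ]
    ((Computes decideCmd from encode I to encodeBool (does {A = Yes I} answer) inTime t) ×
     t ≤ factor * 3 ^ parameter I * size (encode I) ^ degree)
  solve record { G = G ; X = X ; dominating = dom } =
    conclude (runs-decide (matrix G) (toList X) (initial (encodeGraph G ∙ encodeSubset X)) encodes)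
    where
    encodes : encodeGraph G ∙ encodeSubset X ≡ enc INPUT (matrix G , toList X)
    encodes = cong₂ _∙_ (enc-matrix G) (enc-toList X)
    xs : List ℕ
    xs = chosen (matrix G) (toList X)
    N : ℕ
    N = sz INPUT (matrix G , toList X)
    ∣xs∣≡ : length xs ≡ ∣ X ∣
    ∣xs∣≡ = trans (cong (λ vs → length (filterᵇ (nth false (toList X)) vs)) (vertices-matrix G))
                  (length-chosen X)
    bound : 3 ^ length xs * ⟪ decideTime ⟫ N ≤ factor * 3 ^ ∣ X ∣ * size (encodeGraph G ∙ encodeSubset X) ^ degree
    bound = begin
      3 ^ length xs * ⟪ decideTime ⟫ N   ≤⟨ *-monoʳ-≤ (3 ^ length xs) (proj₂ (proj₂ (poly-bounded decideTime)) N) ⟩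
      3 ^ length xs * (factor * N ^ degree)        ≡⟨ cong (λ k → 3 ^ k * (factor * N ^ degree)) ∣xs∣≡ ⟩
      3 ^ ∣ X ∣ * (factor * N ^ degree)            ≡⟨ regroup (3 ^ ∣ X ∣) factor (N ^ degree) ⟩
      factor * 3 ^ ∣ X ∣ * N ^ degree              ≡⟨ cong (λ t → factor * 3 ^ ∣ X ∣ * size t ^ degree) encodes ⟨
      factor * 3 ^ ∣ X ∣ * size (encodeGraph G ∙ encodeSubset X) ^ degree ∎
    conclude :
      ∃[ τ ] ∃[ t ] ((initial (encodeGraph G ∙ encodeSubset X) ⊢ decideCmd ⇓ τ ∣ t) ×
                     τ 0 ≡ encodeBool (decide (matrix G) (toList X)) ×
                     τ 1 ≡ nil × t ≤ 3 ^ length xs * ⟪ decideTime ⟫ N) →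
      ∃[ answer ] ∃[ t ]
        ((Computes decideCmd from encodeGraph G ∙ encodeSubset X
            to encodeBool (does {A = ∃[ S ] IndependentCutset G S} answer) inTime t) ×
         t ≤ factor * 3 ^ ∣ X ∣ * size (encodeGraph G ∙ encodeSubset X) ^ degree)
    conclude (τ , t , C⇓ , τ₀ , _ , t≤) =
      -- `does` of this decision reduces to the Boolean `decide (matrix G) (toList X)`, so `τ₀`
      -- already describes the required output.
      map′ (sound G dom) (complete G X) (T? (decide (matrix G) (toList X))) ,
      t , (τ , C⇓ , τ₀) , ≤-trans t≤ bound
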